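{- The Independent Set Reconfiguration problem (ISR) on $d$-degenerate graphs is fixed-parameter tractable parameterized by $k+d$. That is, the problem whose inputs are a $d$-degenerate graph $G$ (with $d$ given), a positive integer $k$, and two independent sets $I_s, I_t$ of $G$ with $|I_s|=|I_t|=k$, and which asks whether there is a path from $I_s$ to $I_t$ in the reconfiguration graph $R_{\mathrm{IS}}(G,k-1,k)$, is fixed-parameter tractable with parameter $k+d$.
   Context: Graphs are finite, simple and undirected. A graph $G$ is $d$-degenerate if every (nonempty) induced subgraph of $G$ has a vertex of degree at most $d$. The reconfiguration graph $R_{\mathrm{IS}}(G,k-1,k)$ has one node for each independent set of $G$ of size $k-1$ or $k$; two nodes $A,B$ are adjacent iff $|A \mathbin{\Delta} B| = 1$ (symmetric difference). ISR: given $(G,I_s,I_t,k)$ with $I_s,I_t$ independent sets of $G$ of size $k$, decide whether there is a path from $I_s$ to $I_t$ in $R_{\mathrm{IS}}(G,k-1,k)$. A parameterized problem with inputs $(x,p)$, $|x|=n$, $p$ a positive integer, is fixed-parameter tractable if it can be decided in time $f(p)\,n^c$, where $f$ is an arbitrary function and $c$ is a constant independent of $n$ and $p$. -}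

module Defs where

open import Data.Bool using (Bool; true; false; T)
open import Data.Fin using (Fin; zero)
open import Data.Fin.Subset using (Subset; _∈_; _∩_; _∪_; _─_; ∣_∣; Nonempty)
open import Data.Nat using (ℕ; zero; suc; _+_; _*_; _^_; _∸_; _≤_; _<_)
open import Data.Nat.Properties using (<-≤-trans; m≤m+n)
open import Data.List using (List; []; _∷_)
open import Data.Product using (Σ-syntax; ∃-syntax; _×_; _,_)
open import Data.Sum using (_⊎_)
open import Data.Vec using (Vec; _∷_; lookup; tabulate; replicate; toList; _[_]≔_)
open import Function.Bundles using (_⇔_)
open import Relation.Binary.Construct.Closure.ReflexiveTransitive using (Star)
open import Relation.Binary.PropositionalEquality using (_≡_; _≢_)
open import Relation.Nullary using (¬_)

record Graph : Set where
  field
    order  : ℕ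
    adj    : Fin order → Fin order → Bool
    irrefl : ∀ u → ¬ T (adj u u)
    symm   : ∀ u v → T (adj u v) → T (adj v u)

  Vertex : Set
  Vertex = Fin order

  VertexSet : Set
  VertexSet = Subset order

  Adjacent : Vertex → Vertex → Set
  Adjacent u v = T (adj u v)

  neighbours : Vertex → VertexSet
  neighbours v = tabulate (adj v)

  -- For v ∈ S, the degree of v in the subgraph induced by S.
  degreeIn : VertexSet → Vertex → ℕ
  degreeIn S v = ∣ neighbours v ∩ S ∣

  Degenerate : ℕ → Set
  Degenerate d =
    (S : VertexSet) → Nonempty S → ∃[ v ] (v ∈ S × degreeIn S v ≤ d)

  Independent : VertexSet → Set
  Independent S = ∀ u v → u ∈ S → v ∈ S → ¬ Adjacent u v

_△_ : {n : ℕ} → Subset n → Subset n → Subset n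
A △ B = (A ─ B) ∪ (B ─ A)

module Reconfiguration (G : Graph) (k : ℕ) where
  open Graph G

  IsNode : VertexSet → Set
  IsNode A = Independent A × (∣ A ∣ ≡ k ∸ 1 ⊎ ∣ A ∣ ≡ k)

  Edge : VertexSet → VertexSet → Set
  Edge A B = IsNode A × IsNode B × ∣ A △ B ∣ ≡ 1

  -- The empty path has no edge to certify its endpoint, so this is the
  -- path relation of the reconfiguration graph only between nodes.
  Path : VertexSet → VertexSet → Set
  Path = Star Edge

-- Jones's WHILE language over binary trees, as the machine model.  Every
-- operation has unit cost, and the only test is whether a tree is
-- nil (there is no unit-cost comparison of trees).  Since trees are
-- immutable they can be stored as shared pointers, so each operation
-- takes constant time on a RAM with polynomially many cells in the
-- running time; the model is thus polynomially equivalent to Turing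
-- machines, and this equivalence preserves bounds of the form f(p) · nᶜ.

infixr 5 _∙_

data Tree : Set where
  nil : Tree
  _∙_ : Tree → Tree → Tree

size : Tree → ℕ
size nil     = 1
size (s ∙ t) = 1 + size s + size t

head tail : Tree → Tree
head nil     = nil
head (s ∙ t) = s
tail nil     = nil
tail (s ∙ t) = t

data Expr (m : ℕ) : Set where
  var  : Fin m → Expr m
  nil  : Expr m
  cons : Expr m → Expr m → Expr m
  hd   : Expr m → Expr m
  tl   : Expr m → Expr m

infixr 4 _⨾_
infix  5 _≔_

data Cmd (m : ℕ) : Set where
  _≔_           : Fin m → Expr m → Cmd m
  _⨾_           : Cmd m → Cmd m → Cmd m
  if_then_else_ : Expr m → Cmd m → Cmd m → Cmd m
  while_loop_   : Expr m → Cmd m → Cmd m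

Store : ℕ → Set
Store m = Vec Tree m

eval : {m : ℕ} → Expr m → Store m → Tree
eval (var x)    σ = lookup σ x
eval nil        σ = nil
eval (cons e f) σ = eval e σ ∙ eval f σ
eval (hd e)     σ = head (eval e σ)
eval (tl e)     σ = tail (eval e σ)

cost : {m : ℕ} → Expr m → ℕ
cost (var x)    = 1
cost nil        = 1
cost (cons e f) = 1 + cost e + cost f
cost (hd e)     = 1 + cost e
cost (tl e)     = 1 + cost e

-- Exec C σ t τ : started in store σ, the command C halts in store τ
-- after exactly t steps.  Any tree other than nil counts as true.
data Exec {m : ℕ} : Cmd m → Store m → ℕ → Store m → Set where
  assign : ∀ {x e σ} →
    Exec (x ≔ e) σ (1 + cost e) (σ [ x ]≔ eval e σ)
  seq : ∀ {C D σ τ υ s t} →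
    Exec C σ s τ → Exec D τ t υ →
    Exec (C ⨾ D) σ (1 + s + t) υ
  if-true : ∀ {e C D σ τ t} →
    eval e σ ≢ nil → Exec C σ t τ →
    Exec (if e then C else D) σ (1 + cost e + t) τ
  if-false : ∀ {e C D σ τ t} →
    eval e σ ≡ nil → Exec D σ t τ →
    Exec (if e then C else D) σ (1 + cost e + t) τ
  while-true : ∀ {e C σ τ υ s t} →
    eval e σ ≢ nil → Exec C σ s τ → Exec (while e loop C) τ t υ →
    Exec (while e loop C) σ (1 + cost e + s + t) υ
  while-false : ∀ {e C σ} →
    eval e σ ≡ nil →
    Exec (while e loop C) σ (1 + cost e) σ

-- Variable 0 holds the input at the start and the output at the end; all
-- other variables are initially nil.
record Program : Set where
  field
    auxiliaries : ℕ
    body        : Cmd (suc auxiliaries)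

Computes : Program → Tree → ℕ → Tree → Set
Computes P input t output =
  ∃[ τ ] (Exec body (input ∷ replicate auxiliaries nil) t τ
          × lookup τ zero ≡ output)
  where open Program P

encodeBool : Bool → Tree
encodeBool false = nil
encodeBool true  = nil ∙ nil

encodeℕ : ℕ → Tree
encodeℕ zero    = nil
encodeℕ (suc n) = nil ∙ encodeℕ n

encodeList : {A : Set} → (A → Tree) → List A → Tree
encodeList enc []       = nil
encodeList enc (x ∷ xs) = enc x ∙ encodeList enc xs

encodeSubset : {n : ℕ} → Subset n → Tree
encodeSubset S = encodeList encodeBool (toList S)

encodeGraph : Graph → Tree
encodeGraph G = encodeList encodeSubset (toList (tabulate neighbours))
  where open Graph G

-- Instance may be a proper subset of the conceivable inputs; nothing is
-- required of an algorithm on trees that encode no instance.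
record ParameterizedProblem : Set₁ where
  field
    Instance    : Set
    encode      : Instance → Tree
    parameter   : Instance → ℕ
    parameter>0 : ∀ x → 0 < parameter x
    Yes         : Instance → Set

FixedParameterTractable : ParameterizedProblem → Set
FixedParameterTractable Π =
  Σ[ P ∈ Program ] Σ[ f ∈ (ℕ → ℕ) ] Σ[ c ∈ ℕ ]
    ((x : Instance) →
      ∃[ t ] ∃[ output ]
        ( Computes P (encode x ∙ encodeℕ (parameter x)) t output
        × t ≤ f (parameter x) * size (encode x) ^ c
        × (Yes x ⇔ output ≢ nil)))
  where open ParameterizedProblem Π

record ISRInstance : Set where
  open Graph
  field
    G             : Graph
    d             : ℕ
    degenerate    : Degenerate G d
    k             : ℕ
    k>0           : 0 < k
    Iₛ Iₜ         : VertexSet G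
    Iₛ-independent : Independent G Iₛ
    Iₜ-independent : Independent G Iₜ
    ∣Iₛ∣≡k        : ∣ Iₛ ∣ ≡ k
    ∣Iₜ∣≡k        : ∣ Iₜ ∣ ≡ k

-- Writing k and d in unary lengthens the input by at most a factor
-- depending only on the parameter k + d, which f absorbs.
ISR : ParameterizedProblem
ISR = record
  { Instance    = ISRInstance
  ; encode      = λ x → let open ISRInstance x in
      encodeGraph G ∙ encodeℕ d ∙ encodeℕ k ∙ encodeSubset Iₛ ∙ encodeSubset Iₜ
  ; parameter   = λ x → let open ISRInstance x in k + d
  ; parameter>0 = λ x → let open ISRInstance x in <-≤-trans k>0 (m≤m+n k d)
  ; Yes         = λ x → let open ISRInstance x in
      Reconfiguration.Path G k Iₛ Iₜ
  }

module Submission where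

-- Idea.  Let p = k + d and D = 2p + 1.  Call a vertex low in S if it has fewer
-- than D neighbours in S.  If S contains p + 1 low vertices w ≠ u whose closed
-- neighbourhoods are pairwise disjoint outside N[u], then u ∉ Iₛ ∪ Iₜ can be
-- deleted from S: at any time at most k other tokens are present, so a token on
-- u can be simulated by one on some such w whose neighbourhood they miss.  The
-- search for these w is greedy.  When no vertex can be deleted, every low u
-- outside Iₛ ∪ Iₜ has at most p D vertices outside N[u] that meet the closed
-- neighbourhoods of all but p + 1 of the low vertices; choosing the most
-- frequent of these repeatedly builds ever larger sets contained in many closed
-- neighbourhoods, which have at most D elements.  So there are boundedly many
-- low vertices, and hence, by degeneracy, |S| ≤ D ^ (2 D + 4).  It remains to
-- try all walks of length at most 2 ^ (D ^ (2 D + 4)) through subsets of S.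
--
-- The running time is bounded by separating what depends on p alone: programs
-- that lengthen lists compute, from p in unary, all lists that the exhaustive
-- search runs through.  The rest of the algorithm never builds a list longer
-- than those given to it, so each of its nested loops makes at most N rounds,
-- where N bounds the lengths of the given lists, and its time is polynomial in N.

open import Defs renaming (if_then_else_ to when_then_else_)
open import Algebra.Properties.CommutativeSemigroup using (interchange)
open import Data.Bool using (Bool; true; false; not; _∧_; _∨_; if_then_else_; T)
import Data.Bool.Properties as Bool
open import Data.Empty using (⊥-elim)
open import Data.Fin using (Fin; zero; suc; toℕ)
import Data.Fin.Properties as Fin
open import Data.Fin.Subset using (Subset; _∈_; _∉_; _⊆_; _∩_; _∪_; _─_; ∣_∣; ⁅_⁆; Nonempty; inside; outside) renaming (⊥ to ∅; ⊤ to full)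
open import Data.Fin.Subset.Properties
open import Data.List using (List; []; _∷_; _++_; _ʳ++_; allFin; drop; foldl; length; map; replicate)
open import Data.List.Membership.Propositional using () renaming (_∈_ to _∈ₗ_; _∉_ to _∉ₗ_)
open import Data.List.Membership.Propositional.Properties using (∈-allFin; ∈-map⁺; ∈-map⁻; ∈-++⁺ˡ; ∈-++⁺ʳ; ∈-++⁻; ∈-∃++)
import Data.List.Properties as List
open import Data.List.Properties using (length-replicate; length-++; length-map)
open import Data.List.Relation.Unary.All using (All; []; _∷_)
import Data.List.Relation.Unary.All as All
open import Data.List.Relation.Unary.All.Properties using (map⁺; ++⁺; replicate⁺)
open import Data.List.Relation.Unary.Any using (here; there; any?)
open import Data.Nat hiding (_≡ᵇ_; _≟_)
open import Data.Nat.Properties hiding (_≟_)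
open import Data.Product using (∃-syntax; _×_; _,_; proj₁; proj₂)
open import Data.Sum using (_⊎_; inj₁; inj₂)
open import Data.Unit using (⊤; tt)
open import Data.Vec using (Vec; []; _∷_; toList; lookup; tabulate; zipWith; _[_]≔_)
import Data.Vec.Properties as Vec
open import Function using (_∘_; id; case_of_)
open import Function.Bundles using (_⇔_; mk⇔; Equivalence)
open import Relation.Binary.Construct.Closure.ReflexiveTransitive using (Star; ε; _◅_; _◅◅_)
import Relation.Binary.Construct.Closure.ReflexiveTransitive as Star
open import Relation.Binary.PropositionalEquality hiding (J)
open import Relation.Nullary using (¬_; Dec; yes; no; does; contradiction; ¬?; _×-dec_)
open import Relation.Nullary.Decidable using (dec-true; dec-false; does-⇔)

-- A language of loop programs and its compiler

-- Deleting `u` resembles a sunflower argument: `N[u]` acts as the core, and the closed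
-- neighbourhoods of the `w` are the petals. While `u` carries a token, independence keeps all other
-- tokens off `N[u]`, so disjointness outside `N[u]` is enough, and `k` tokens cannot meet all of
-- `p + 1 > k` petals. The delicate point is that a substitute chosen now may block a vertex that is
-- entered later, so the exchange has to look one step ahead.
--
-- Lowness keeps petals small: a maximal family of at most `p` of them leaves a hitting set of at
-- most `p D` vertices. The value `D = 2p + 1` exceeds `2d`, the bound that degeneracy puts on the
-- average degree, so vertices that are not low cannot dominate.
--
-- The running time is not tied to the actual size of the kernel. The tables fix in advance the
-- number of codes for its subsets, and the size bound only shows that they suffice. A positive
-- answer always comes with a walk in `G` itself, so the kernel matters for completeness alone.

infixr 6 _⊗_

data Ty : Set where
  bit     : Ty
  list vec : Ty → Ty
  _⊗_     : Ty → Ty → Ty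

-- vec a is the type of lists whose length is the order n of the input graph.
⟪_⟫ : Ty → ℕ → Set
⟪ bit ⟫    n = Bool
⟪ list a ⟫ n = List (⟪ a ⟫ n)
⟪ vec a ⟫  n = Vec (⟪ a ⟫ n) n
⟪ a ⊗ b ⟫  n = ⟪ a ⟫ n × ⟪ b ⟫ n

enc : ∀ a n → ⟪ a ⟫ n → Tree
enc bit      n x       = encodeBool x
enc (list a) n x       = encodeList (enc a n) x
enc (vec a)  n x       = encodeList (enc a n) (toList x)
enc (a ⊗ b)  n (x , y) = enc a n x ∙ enc b n y

-- A fold that also emits one output per entry. The output is as long as the input, which lets
-- `scanF` build new values of type `vec` without any means of lengthening a list.
scan : {S A B : Set} {m : ℕ} → (S → A → S × B) → S → Vec A m → S × Vec B m
scan f s []       = s , []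
scan f s (x ∷ xs) =
  let s₁ , y  = f s x
      s₂ , ys = scan f s₁ xs
  in  s₂ , y ∷ ys

tail′ : {A : Set} → List A → List A
tail′ []       = []
tail′ (x ∷ xs) = xs

nonempty : {A : Set} → List A → Bool
nonempty []      = false
nonempty (_ ∷ _) = true

-- The default `false`, like `tail′ [] ≡ []`, is what `hd` and `tl` yield on `nil`, so the compiled
-- code needs no emptiness test.
headBit : List Bool → Bool
headBit []      = false
headBit (b ∷ _) = b

infixr 9 _∘F_

-- The index c tells whether consF, which alone makes lists longer, is allowed.
data Fun (c : Bool) : Ty → Ty → Set
⟦_⟧ : ∀ {c a b} → Fun c a b → ∀ n → ⟪ a ⟫ n → ⟪ b ⟫ n

data Fun c where
  idF       : ∀ {a} → Fun c a a
  _∘F_      : ∀ {a b d} → Fun c b d → Fun c a b → Fun c a d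
  ⟨_,_⟩     : ∀ {a b d} → Fun c a b → Fun c a d → Fun c a (b ⊗ d)
  fstF      : ∀ {a b} → Fun c (a ⊗ b) a
  sndF      : ∀ {a b} → Fun c (a ⊗ b) b
  bitF      : ∀ {a} → Bool → Fun c a bit
  ifF       : ∀ {a b} → Fun c a bit → Fun c a b → Fun c a b → Fun c a b
  nonemptyF : ∀ {a} → Fun c (list a) bit
  tailF     : ∀ {a} → Fun c (list a) (list a)
  headF     : Fun c (list bit) bit
  listF     : ∀ {a} → Fun c (vec a) (list a)
  nilF      : ∀ {a b} → Fun c a (list b)
  consF     : ∀ {a} → c ≡ true → Fun c (a ⊗ list a) (list a)
  loopF     : ∀ {a s x} → Fun c ((a ⊗ s) ⊗ x) s → Fun c ((a ⊗ s) ⊗ list x) s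
  scanF     : ∀ {a s x y} → Fun c ((a ⊗ s) ⊗ x) (s ⊗ y) → Fun c ((a ⊗ s) ⊗ vec x) (s ⊗ vec y)
  -- The same program, with another description of the function it computes.
  by        : ∀ {a b} (F : Fun c a b) (g : ∀ n → ⟪ a ⟫ n → ⟪ b ⟫ n) → (∀ n x → ⟦ F ⟧ n x ≡ g n x) → Fun c a b

⟦ idF ⟧       n x = x
⟦ G ∘F F ⟧    n x = ⟦ G ⟧ n (⟦ F ⟧ n x)
⟦ ⟨ F , G ⟩ ⟧ n x = ⟦ F ⟧ n x , ⟦ G ⟧ n x
⟦ fstF ⟧      n x = proj₁ x
⟦ sndF ⟧      n x = proj₂ x
⟦ bitF b ⟧    n x = b
⟦ ifF B F G ⟧ n x = if ⟦ B ⟧ n x then ⟦ F ⟧ n x else ⟦ G ⟧ n x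
⟦ nonemptyF ⟧ n x = nonempty x
⟦ tailF ⟧     n x = tail′ x
⟦ headF ⟧     n x = headBit x
⟦ listF ⟧     n x = toList x
⟦ nilF ⟧      n x = []
⟦ consF _ ⟧   n x = proj₁ x ∷ proj₂ x
⟦ loopF F ⟧   n x = foldl (λ s y → ⟦ F ⟧ n ((proj₁ (proj₁ x) , s) , y)) (proj₂ (proj₁ x)) (proj₂ x)
⟦ scanF F ⟧   n x = scan (λ s y → ⟦ F ⟧ n ((proj₁ (proj₁ x) , s) , y)) (proj₂ (proj₁ x)) (proj₂ x)
⟦ by F g _ ⟧  n x = g n x

-- Two variables suffice: one holds the argument and then the result, the other a stack of saved
-- values in the form of nested pairs. Compiled code leaves the stack as it found it.
pattern value = zero
pattern stack = suc zero

V W : Expr 2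
V = var value
W = var stack

-- The top of the stack is `((a , s) , ys)` for `loopBody`, with fixed argument `a`, state `s` and
-- remaining entries `ys`; for `scanBody` it is `(((a , s) , ys) , out)`. Outputs are pushed onto
-- `out` and so pile up in reverse; `revBody` later restores their order.
loopBody scanBody : Cmd 2 → Cmd 2
loopBody C =
    value ≔ cons (hd (hd W)) (hd (tl (hd W)))
  ⨾ stack ≔ cons (cons (hd (hd W)) (tl (tl (hd W)))) (tl W)
  ⨾ C
  ⨾ stack ≔ cons (cons (cons (hd (hd (hd W))) V) (tl (hd W))) (tl W)
scanBody C =
    value ≔ cons (hd (hd (hd W))) (hd (tl (hd (hd W))))
  ⨾ stack ≔ cons (cons (cons (hd (hd (hd W))) (tl (tl (hd (hd W))))) (tl (hd W))) (tl W)
  ⨾ C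
  ⨾ stack ≔ cons (cons (cons (cons (hd (hd (hd (hd W)))) (hd V)) (tl (hd (hd W)))) (cons (tl V) (tl (hd W)))) (tl W)

revBody : Cmd 2
revBody =
    value ≔ cons (cons (hd (hd V)) (cons (hd (tl V)) (tl (hd V)))) (tl (tl V))

code : ∀ {c a b} → Fun c a b → Cmd 2
code idF         = value ≔ V
code (G ∘F F)    = code F ⨾ code G
code ⟨ F , G ⟩   =
    stack ≔ cons V W
  ⨾ code F
  ⨾ stack ≔ cons V W
  ⨾ value ≔ hd (tl W)
  ⨾ stack ≔ cons (hd W) (tl (tl W))
  ⨾ code G
  ⨾ value ≔ cons (hd W) V
  ⨾ stack ≔ tl W
code fstF        = value ≔ hd V
code sndF        = value ≔ tl V
code (bitF false) = value ≔ nil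
code (bitF true) = value ≔ cons nil nil
code (ifF B F G) =
    stack ≔ cons V W
  ⨾ code B
  ⨾ when V then (value ≔ hd W ⨾ stack ≔ tl W ⨾ code F) else (value ≔ hd W ⨾ stack ≔ tl W ⨾ code G)
code nonemptyF   = when V then (value ≔ cons nil nil) else (value ≔ nil)
code tailF       = value ≔ tl V
code headF       = value ≔ hd V
code listF       = value ≔ V
code nilF        = value ≔ nil
code (consF _)   = value ≔ V
code (loopF F)   =
    stack ≔ cons V W
  ⨾ while tl (hd W) loop loopBody (code F)
  ⨾ value ≔ tl (hd (hd W))
  ⨾ stack ≔ tl W
code (scanF F)   =
    stack ≔ cons (cons V nil) W
  ⨾ while tl (hd (hd W)) loop scanBody (code F)
  ⨾ value ≔ cons (cons (tl (hd (hd (hd W)))) nil) (tl (hd W))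
  ⨾ stack ≔ tl W
  ⨾ while tl V loop revBody
  ⨾ value ≔ hd V
code (by F _ _)  = code F

revTime : ℕ → ℕ → ℕ
revTime zero    k = k
revTime (suc m) k = revTime m (19 + k)

module _ {c : Bool} where
  -- Exact step counts, bracketed like the indices of `Exec` for `code`, so that `run` needs no
  -- arithmetic: both sides agree by computation.
  time : ∀ {a b} → Fun c a b → ∀ n → ⟪ a ⟫ n → ℕ
  loopTime : ∀ {a s x} → Fun c ((a ⊗ s) ⊗ x) s → ∀ n → ⟪ a ⟫ n → ⟪ s ⟫ n → List (⟪ x ⟫ n) → ℕ
  scanTime : ∀ {a s x y} → Fun c ((a ⊗ s) ⊗ x) (s ⊗ y) → ∀ n → ⟪ a ⟫ n → ⟪ s ⟫ n → ∀ {m} → Vec (⟪ x ⟫ n) m → ℕ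

  time idF         n x = 2
  time (G ∘F F)    n x = 1 + time F n x + time G n (⟦ F ⟧ n x)
  time ⟨ F , G ⟩   n x = 6 + (time F n x + (19 + (time G n x + 9)))
  time fstF        n x = 3
  time sndF        n x = 3
  time (bitF false) n x = 2
  time (bitF true) n x = 4
  time (ifF B F G) n x = 6 + (time B n x + (10 + (if ⟦ B ⟧ n x then time F n x else time G n x)))
  time nonemptyF   n []      = 4
  time nonemptyF   n (_ ∷ _) = 6
  time tailF       n x = 3
  time headF       n x = 3
  time listF       n x = 2
  time nilF        n x = 2
  time (consF _)   n x = 2
  time (loopF F)   n ((x , s) , ys) = 6 + (loopTime F n x s ys + 9)
  time (scanF {s = s} {y = b} F) n ((x , s₀) , ys) = 8 + (scanTime F n x s₀ ys + (18 + (revTime n 3 + 3)))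
  time (by F _ _)  n x = time F n x

  loopTime F n x s []       = 4
  loopTime F n x s (y ∷ ys) = 28 + ((time F n ((x , s) , y) + 14) + loopTime F n x (⟦ F ⟧ n ((x , s) , y)) ys)
  scanTime F n x s []       = 5
  scanTime F n x s (y ∷ ys) = 37 + ((time F n ((x , s) , y) + 24) + scanTime F n x (proj₁ (⟦ F ⟧ n ((x , s) , y))) ys)


revOnto : {A : Set} {m : ℕ} → (A → Tree) → Vec A m → Tree → Tree
revOnto e []       o = o
revOnto e (x ∷ xs) o = revOnto e xs (e x ∙ o)

encOnto : {A : Set} {m : ℕ} → (A → Tree) → Vec A m → Tree → Tree
encOnto e []       o = o
encOnto e (x ∷ xs) o = e x ∙ encOnto e xs o

encOnto-nil : {A : Set} {m : ℕ} (e : A → Tree) (xs : Vec A m) → encOnto e xs nil ≡ encodeList e (toList xs)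
encOnto-nil e []       = refl
encOnto-nil e (x ∷ xs) = cong (e x ∙_) (encOnto-nil e xs)

-- The last output lies on top of `revOnto e xs o`, so the rounds for later entries come first.
-- Hence the run of the remaining loop is an argument, extended by one round per entry, and
-- `revTime` accumulates likewise.
runRev : {A : Set} (e : A → Tree) {m : ℕ} (xs : Vec A m) (s a o st : Tree) {k : ℕ} {τ : Store 2} →
  Exec (while tl V loop revBody) (((s ∙ encOnto e xs a) ∙ o) ∷ st ∷ []) k τ →
  Exec (while tl V loop revBody) (((s ∙ a) ∙ revOnto e xs o) ∷ st ∷ []) (revTime m k) τ
runRev e []       s a o st r = r
runRev e (x ∷ xs) s a o st r = runRev e xs s a (e x ∙ o) st (while-true (λ ()) assign r)

module _ {c : Bool} where
  runLoop : ∀ {a s x} (F : Fun c ((a ⊗ s) ⊗ x) s) n z₀ s₀ ys t st → ∃[ t′ ]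
    Exec (while tl (hd W) loop loopBody (code F))
      (t ∷ (((enc a n z₀ ∙ enc s n s₀) ∙ enc (list x) n ys) ∙ st) ∷ [])
      (loopTime F n z₀ s₀ ys)
      (t′ ∷ (((enc a n z₀ ∙ enc s n (⟦ loopF F ⟧ n ((z₀ , s₀) , ys))) ∙ nil) ∙ st) ∷ [])
  runScan : ∀ {a s x y} (F : Fun c ((a ⊗ s) ⊗ x) (s ⊗ y)) n z₀ s₀ {m} (ys : Vec (⟪ x ⟫ n) m) t o st → ∃[ t′ ]
    Exec (while tl (hd (hd W)) loop scanBody (code F))
      (t ∷ ((((enc a n z₀ ∙ enc s n s₀) ∙ encodeList (enc x n) (toList ys)) ∙ o) ∙ st) ∷ [])
      (scanTime F n z₀ s₀ ys)
      (t′ ∷ ((((enc a n z₀ ∙ enc s n (proj₁ (scan (λ s y → ⟦ F ⟧ n ((z₀ , s) , y)) s₀ ys))) ∙ nil)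
        ∙ revOnto (enc y n) (proj₂ (scan (λ s y → ⟦ F ⟧ n ((z₀ , s) , y)) s₀ ys)) o) ∙ st) ∷ [])

  run : ∀ {a b} (F : Fun c a b) n x st → Exec (code F) (enc a n x ∷ st ∷ []) (time F n x) (enc b n (⟦ F ⟧ n x) ∷ st ∷ [])
  run idF         n x st = assign
  run (G ∘F F)    n x st = seq (run F n x st) (run G n (⟦ F ⟧ n x) st)
  run {a} ⟨ F , G ⟩   n x st = seq assign (seq (run F n x (enc a n x ∙ st)) (seq assign (seq assign (seq assign (seq (run G n x _) (seq assign assign))))))
  run fstF        n x st = assign
  run sndF        n x st = assign
  run (bitF false) n x st = assign
  run (bitF true) n x st = assign
  run {a} (ifF B F G) n x st with ⟦ B ⟧ n x | run B n x (enc a n x ∙ st)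
  ... | false | r = seq assign (seq r (if-false refl (seq assign (seq assign (run G n x st)))))
  ... | true  | r = seq assign (seq r (if-true (λ ()) (seq assign (seq assign (run F n x st)))))
  run nonemptyF   n []      st = if-false refl assign
  run nonemptyF   n (_ ∷ _) st = if-true (λ ()) assign
  run tailF       n []      st = assign
  run tailF       n (_ ∷ _) st = assign
  run headF       n []      st = assign
  run headF       n (_ ∷ _) st = assign
  run listF       n x st = assign
  run nilF        n x st = assign
  run (consF _)   n x st = assign
  run (loopF F)   n ((x , s) , ys) st =
    seq assign (seq (proj₂ (runLoop F n x s ys _ st)) (seq assign assign))
  run {b = s′ ⊗ vec y′} (scanF F) n ((x , s) , ys) st =
    seq assign (seq (proj₂ (runScan F n x s ys _ nil st)) (seq assign (seq assign
      (seq (runRev (enc _ n) zs _ nil nil st (while-false refl))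
        (subst (λ o → Exec (value ≔ hd V) (((enc s′ n s₁ ∙ encOnto (enc y′ n) zs nil) ∙ nil) ∷ st ∷ [])
            3 ((enc s′ n s₁ ∙ o) ∷ st ∷ []))
          (encOnto-nil (enc y′ n) zs) assign)))))
    where
    s₁ = proj₁ (⟦ scanF F ⟧ n ((x , s) , ys))
    zs = proj₂ (⟦ scanF F ⟧ n ((x , s) , ys))
  run (by F g p)  n x st = subst (λ z → Exec _ _ _ (enc _ n z ∷ _)) (p n x) (run F n x st)

  runLoop F n z₀ s₀ []       t st = _ , while-false refl
  runLoop F n z₀ s₀ (y ∷ ys) t st =
    _ , while-true (λ ())
          (seq assign (seq assign (seq (run F n ((z₀ , s₀) , y) _) assign)))
          (proj₂ (runLoop F n z₀ _ ys _ st))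

  runScan F n z₀ s₀ []       t o st = _ , while-false refl
  runScan F n z₀ s₀ (y ∷ ys) t o st =
    _ , while-true (λ ())
          (seq assign (seq assign (seq (run F n ((z₀ , s₀) , y) _) assign)))
          (proj₂ (runScan F n z₀ _ ys _ _ st))

-- Programs without consF run in polynomial time

-- Only the lengths of lists matter, at every depth: they limit the rounds of loops, whereas a basic
-- operation has unit cost however large its trees are.
Bounded : ∀ a (N n : ℕ) → ⟪ a ⟫ n → Set
Bounded bit      N n x       = ⊤
Bounded (list a) N n xs      = length xs ≤ N × All (Bounded a N n) xs
Bounded (vec a)  N n xs      = n ≤ N × All (Bounded a N n) (toList xs)
Bounded (a ⊗ b)  N n (x , y) = Bounded a N n x × Bounded b N n y

Bounded-mono : ∀ a {M N n x} → M ≤ N → Bounded a M n x → Bounded a N n x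
Bounded-mono bit      M≤N b       = tt
Bounded-mono (list a) M≤N (l , b) = ≤-trans l M≤N , All.map (Bounded-mono a M≤N) b
Bounded-mono (vec a)  M≤N (l , b) = ≤-trans l M≤N , All.map (Bounded-mono a M≤N) b
Bounded-mono (a ⊗ b)  M≤N (p , q) = Bounded-mono a M≤N p , Bounded-mono b M≤N q

foldl-preserves : {A S : Set} {P : S → Set} {Q : A → Set} {f : S → A → S} →
  (∀ s {y} → P s → Q y → P (f s y)) → ∀ {s ys} → P s → All Q ys → P (foldl f s ys)
foldl-preserves h p []       = p
foldl-preserves h p (q ∷ qs) = foldl-preserves h (h _ p q) qs

scan-preserves : {A B S : Set} {P : S → Set} {Q : A → Set} {R : B → Set} {f : S → A → S × B} →
  (∀ {s y} → P s → Q y → P (proj₁ (f s y)) × R (proj₂ (f s y))) →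
  ∀ {m s} (ys : Vec A m) → P s → All Q (toList ys) →
  P (proj₁ (scan f s ys)) × All R (toList (proj₂ (scan f s ys)))
scan-preserves h []       p []       = p , []
scan-preserves h (y ∷ ys) p (q ∷ qs) =
  let p₁ , r  = h p q
      p₂ , rs = scan-preserves h ys p₁ qs
  in  p₂ , r ∷ rs

-- The one constructor that lengthens a list, `consF`, would demand `false ≡ true`. The same `N`
-- therefore bounds every intermediate state of a loop, whatever the number of rounds.
preserves : ∀ {a b} (F : Fun false a b) {N n x} → Bounded a N n x → Bounded b N n (⟦ F ⟧ n x)
preserves idF         b = b
preserves (G ∘F F)    b = preserves G (preserves F b)
preserves ⟨ F , G ⟩   b = preserves F b , preserves G b
preserves fstF        b = proj₁ b
preserves sndF        b = proj₂ b
preserves (bitF _)    b = tt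
preserves (ifF C F G) {n = n} {x} b with ⟦ C ⟧ n x
... | false = preserves G b
... | true  = preserves F b
preserves nonemptyF   b = tt
preserves tailF {x = []} b = b
preserves tailF {x = x ∷ xs} (l , _ ∷ b) = ≤-trans (n≤1+n _) l , b
preserves headF       b = tt
preserves listF {x = x} (l , b) = ≤-trans (≤-reflexive (Vec.length-toList x)) l , b
preserves nilF        b = z≤n , []
preserves (loopF F)   ((b₁ , b₂) , (_ , b₃)) =
  foldl-preserves {P = Bounded _ _ _} (λ s p q → preserves F {x = (_ , s) , _} ((b₁ , p) , q)) b₂ b₃
preserves (scanF F) {x = _ , ys} ((b₁ , b₂) , (l , b₃)) =
  let p , q = scan-preserves (λ p q → preserves F ((b₁ , p) , q)) ys b₂ b₃
  in  p , (l , q)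
preserves (by F g p) {n = n} {x} b = subst (Bounded _ _ n) (p n x) (preserves F b)

infixl 6 _⊕_
-- The exponent for a sum: since the base `2 + N` is at least 2, two terms that are at most its
-- power `a + b` add up to at most the next power.
_⊕_ : ℕ → ℕ → ℕ
a ⊕ b = suc (a + b)

-- A record, so that the type checker does not expand the powers.
record Below (N x e : ℕ) : Set where
  constructor below
  field bound : x ≤ (2 + N) ^ e

module _ {N : ℕ} where
  open ≤-Reasoning

  const-≤ : ∀ c → Below N c c
  const-≤ zero    = below z≤n
  const-≤ (suc c) = below (begin
    1 + c                          ≤⟨ +-mono-≤ (m^n>0 (2 + N) c) (Below.bound (const-≤ c)) ⟩
    (2 + N) ^ c + (2 + N) ^ c      ≤⟨ +-monoʳ-≤ ((2 + N) ^ c) (m≤m+n ((2 + N) ^ c) _) ⟩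
    (2 + N) ^ suc c                ∎)

  weaken-≤ : ∀ {x a b} → a ≤ b → Below N x a → Below N x b
  weaken-≤ p (below q) = below (≤-trans q (^-monoʳ-≤ (2 + N) p))

  add-≤ : ∀ {x y} a b → Below N x a → Below N y b → Below N (x + y) (a ⊕ b)
  add-≤ {x} {y} a b p q = below (begin
    x + y                                   ≤⟨ +-mono-≤ (Below.bound (weaken-≤ (m≤m+n a b) p))
                                                        (Below.bound (weaken-≤ (m≤n+m b a) q)) ⟩
    (2 + N) ^ (a + b) + (2 + N) ^ (a + b)   ≤⟨ +-monoʳ-≤ ((2 + N) ^ (a + b)) (m≤m+n ((2 + N) ^ (a + b)) _) ⟩
    (2 + N) ^ (a ⊕ b)                       ∎)

  iterate-≤ : ∀ {m x} a → m ≤ N → Below N x a → Below N (m * x) (suc a)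
  iterate-≤ a p (below q) = below (*-mono-≤ (≤-trans p (m≤n+m N 2)) q)

  power-≤ : ∀ e → Below N ((2 + N) ^ e) e
  power-≤ e = below ≤-refl

  lower-≤ : ∀ {x y e} → x ≤ y → Below N y e → Below N x e
  lower-≤ p (below q) = below (≤-trans p q)

revTime-≡ : ∀ m k → revTime m k ≡ m * 19 + k
revTime-≡ zero    k = refl
revTime-≡ (suc m) k = begin
  revTime m (19 + k)  ≡⟨ revTime-≡ m (19 + k) ⟩
  m * 19 + (19 + k)   ≡⟨ sym (+-assoc (m * 19) 19 k) ⟩
  m * 19 + 19 + k     ≡⟨ cong (_+ k) (+-comm (m * 19) 19) ⟩
  19 + m * 19 + k     ∎
  where open ≡-Reasoning

-- Follows the clauses of `time` but depends on the program alone. The `suc` in the loop clauses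
-- pays for the number of rounds, at most `N`; the exponents of two branches are added, which
-- dominates both.
degree : ∀ {a b} → Fun false a b → ℕ
degree idF         = 2
degree (G ∘F F)    = 1 ⊕ degree F ⊕ degree G
degree ⟨ F , G ⟩   = 6 ⊕ (degree F ⊕ (19 ⊕ (degree G ⊕ 9)))
degree fstF        = 3
degree sndF        = 3
degree (bitF _)    = 4
degree (ifF C F G) = 6 ⊕ (degree C ⊕ (10 ⊕ (degree F + degree G)))
degree nonemptyF   = 6
degree tailF       = 3
degree headF       = 3
degree listF       = 2
degree nilF        = 2
degree (loopF F)   = 6 ⊕ (suc (28 ⊕ (degree F ⊕ 14)) ⊕ 4 ⊕ 9)
degree (scanF F)   = 8 ⊕ (suc (37 ⊕ (degree F ⊕ 24)) ⊕ 5 ⊕ (18 ⊕ ((20 ⊕ 3) ⊕ 3)))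
degree (by F _ _)  = degree F

time-≤ : ∀ {a b} (F : Fun false a b) {N n x} → Bounded a N n x → Below N (time F n x) (degree F)
loopTime-≤ : ∀ {a s x} (F : Fun false ((a ⊗ s) ⊗ x) s) {N n z t ys} →
  Bounded a N n z → Bounded s N n t → All (Bounded x N n) ys →
  loopTime F n z t ys ≤ length ys * (28 + ((2 + N) ^ degree F + 14)) + 4
scanTime-≤ : ∀ {a s x y} (F : Fun false ((a ⊗ s) ⊗ x) (s ⊗ y)) {N n z t m} (ys : Vec (⟪ x ⟫ n) m) →
  Bounded a N n z → Bounded s N n t → All (Bounded x N n) (toList ys) →
  scanTime F n z t ys ≤ m * (37 + ((2 + N) ^ degree F + 24)) + 5

time-≤ idF         b = const-≤ 2
time-≤ (G ∘F F)    b = add-≤ _ _ (add-≤ 1 _ (const-≤ 1) (time-≤ F b)) (time-≤ G (preserves F b))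
time-≤ ⟨ F , G ⟩   b =
  add-≤ 6 _ (const-≤ 6) (add-≤ (degree F) _ (time-≤ F b) (add-≤ 19 _ (const-≤ 19)
    (add-≤ (degree G) 9 (time-≤ G b) (const-≤ 9))))
time-≤ fstF        b = const-≤ 3
time-≤ sndF        b = const-≤ 3
time-≤ (bitF false) b = weaken-≤ {a = 2} {4} (s≤s (s≤s z≤n)) (const-≤ 2)
time-≤ (bitF true) b = const-≤ 4
time-≤ (ifF C F G) {N} {n} {x} b =
  add-≤ 6 _ (const-≤ 6) (add-≤ (degree C) _ (time-≤ C b) (add-≤ 10 (degree F + degree G) (const-≤ 10) branch))
  where
  branch : Below N (if ⟦ C ⟧ n x then time F n x else time G n x) (degree F + degree G)
  branch with ⟦ C ⟧ n x
  ... | false = weaken-≤ (m≤n+m _ (degree F)) (time-≤ G b)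
  ... | true  = weaken-≤ (m≤m+n _ _) (time-≤ F b)
time-≤ nonemptyF {x = []}    b = weaken-≤ {a = 4} {6} (s≤s (s≤s (s≤s (s≤s z≤n)))) (const-≤ 4)
time-≤ nonemptyF {x = _ ∷ _} b = const-≤ 6
time-≤ tailF       b = const-≤ 3
time-≤ headF       b = const-≤ 3
time-≤ listF       b = const-≤ 2
time-≤ nilF        b = const-≤ 2
time-≤ (loopF F) {N} ((b₁ , b₂) , (l , b₃)) =
  add-≤ 6 _ (const-≤ 6) (add-≤ (suc (28 ⊕ (degree F ⊕ 14)) ⊕ 4) 9
    (lower-≤ (loopTime-≤ F b₁ b₂ b₃)
      (add-≤ (suc (28 ⊕ (degree F ⊕ 14))) 4
        (iterate-≤ (28 ⊕ (degree F ⊕ 14)) l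
          (add-≤ 28 _ (const-≤ 28) (add-≤ (degree F) 14 (power-≤ _) (const-≤ 14))))
        (const-≤ 4)))
    (const-≤ 9))
time-≤ (scanF F) {N} {n} {_ , ys} ((b₁ , b₂) , (l , b₃)) =
  add-≤ 8 _ (const-≤ 8) (add-≤ (suc (37 ⊕ (degree F ⊕ 24)) ⊕ 5) (18 ⊕ ((20 ⊕ 3) ⊕ 3))
    (lower-≤ (scanTime-≤ F ys b₁ b₂ b₃)
      (add-≤ (suc (37 ⊕ (degree F ⊕ 24))) 5
        (iterate-≤ (37 ⊕ (degree F ⊕ 24)) l
          (add-≤ 37 _ (const-≤ 37) (add-≤ (degree F) 24 (power-≤ _) (const-≤ 24))))
        (const-≤ 5)))
    (add-≤ 18 _ (const-≤ 18) (add-≤ (20 ⊕ 3) 3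
      (lower-≤ (≤-reflexive (revTime-≡ n 3)) (add-≤ 20 3 (iterate-≤ 19 l (const-≤ 19)) (const-≤ 3)))
      (const-≤ 3))))
time-≤ (by F _ _)  b = time-≤ F b

step-≤ : ∀ {c t r l R} (e k : ℕ) → t ≤ e → r ≤ l * (c + (e + k)) + R → c + ((t + k) + r) ≤ suc l * (c + (e + k)) + R
step-≤ {c} {t} {r} {l} {R} e k p q = begin
  c + ((t + k) + r)                              ≤⟨ +-monoʳ-≤ c (+-mono-≤ (+-monoˡ-≤ k p) q) ⟩
  c + ((e + k) + (l * (c + (e + k)) + R))        ≡⟨ sym (+-assoc c (e + k) _) ⟩
  c + (e + k) + (l * (c + (e + k)) + R)          ≡⟨ sym (+-assoc (c + (e + k)) _ R) ⟩
  suc l * (c + (e + k)) + R                      ∎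
  where open ≤-Reasoning

loopTime-≤ F {ys = []}     b₁ b₂ []       = ≤-refl
loopTime-≤ F {N} {ys = y ∷ ys} b₁ b₂ (b ∷ bs) =
  step-≤ {c = 28} {l = length ys} ((2 + N) ^ degree F) 14 (Below.bound (time-≤ F ((b₁ , b₂) , b)))
    (loopTime-≤ F b₁ (preserves F ((b₁ , b₂) , b)) bs)
scanTime-≤ F []       b₁ b₂ []       = ≤-refl
scanTime-≤ F {N} {m = suc m} (y ∷ ys) b₁ b₂ (b ∷ bs) =
  step-≤ {c = 37} {l = m} ((2 + N) ^ degree F) 24 (Below.bound (time-≤ F ((b₁ , b₂) , b)))
    (scanTime-≤ F ys b₁ (proj₁ (preserves F ((b₁ , b₂) , b))) bs)

-- Meant for the precomputed tables: as the factor `f` may be arbitrary, any bound that depends on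
-- `p` alone will do.
Bounded-exists : ∀ a n (x : ⟪ a ⟫ n) → ∃[ N ] Bounded a N n x
All-bounded : ∀ a n (xs : List (⟪ a ⟫ n)) → ∃[ N ] All (Bounded a N n) xs
Bounded-exists bit      n x  = 0 , tt
Bounded-exists (list a) n xs =
  let N , b = All-bounded a n xs
  in  length xs + N , m≤m+n _ _ , All.map (Bounded-mono a (m≤n+m N _)) b
Bounded-exists (vec a)  n xs =
  let N , b = All-bounded a n (toList xs)
  in  n + N , m≤m+n _ _ , All.map (Bounded-mono a (m≤n+m N _)) b
Bounded-exists (a ⊗ b)  n (x , y) =
  let M , p = Bounded-exists a n x
      N , q = Bounded-exists b n y
  in  M + N , Bounded-mono a (m≤m+n M N) p , Bounded-mono b (m≤n+m N M) q
All-bounded a n []       = 0 , []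
All-bounded a n (x ∷ xs) =
  let M , p = Bounded-exists a n x
      N , q = All-bounded a n xs
  in  M + N , Bounded-mono a (m≤m+n M N) p ∷ All.map (Bounded-mono a (m≤n+m N M)) q

-- Encoding of instances and assembly of the machine program

-- `Tables` consists of `p + 1`, `D` and `1` in unary, the codes for subsets of the kernel, and the
-- sequences of codes to be tried.
Input Tables : Ty
Input  = vec (vec bit) ⊗ list bit ⊗ list bit ⊗ vec bit ⊗ vec bit
Tables = list bit ⊗ list bit ⊗ list bit ⊗ list (list bit) ⊗ list (list (list bit))

unary : ℕ → List Bool
unary m = replicate m false

enc-unary : ∀ m → encodeList encodeBool (unary m) ≡ encodeℕ m
enc-unary zero    = refl
enc-unary (suc m) = cong (nil ∙_) (enc-unary m)

module _ (x : ISRInstance) where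
  open ISRInstance x
  open Graph G

  orderOf parameterOf : ℕ
  orderOf     = order
  parameterOf = k + d

  input : ⟪ Input ⟫ order
  input = tabulate neighbours , unary d , unary k , Iₛ , Iₜ

  encode-input : enc Input order input ≡ ParameterizedProblem.encode ISR x
  encode-input = cong₂ (λ s t → encodeGraph G ∙ s ∙ t ∙ encodeSubset Iₛ ∙ encodeSubset Iₜ) (enc-unary d) (enc-unary k)

size>0 : ∀ t → 1 ≤ size t
size>0 nil     = s≤s z≤n
size>0 (s ∙ t) = s≤s z≤n

size-left : ∀ s t → size s ≤ size (s ∙ t)
size-left s t = ≤-trans (m≤m+n (size s) (size t)) (n≤1+n _)

size-right : ∀ s t → size t ≤ size (s ∙ t)
size-right s t = ≤-trans (m≤n+m (size t) (size s)) (n≤1+n _)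

length≤size : ∀ {A : Set} (e : A → Tree) {m} (xs : Vec A m) → m ≤ size (encodeList e (toList xs))
length≤size e []       = z≤n
length≤size e (x ∷ xs) = s≤s (≤-trans (length≤size e xs) (m≤n+m _ (size (e x))))

ℕ≤size : ∀ m → m ≤ size (encodeℕ m)
ℕ≤size zero    = z≤n
ℕ≤size (suc m) = s≤s (≤-trans (ℕ≤size m) (n≤1+n _))

All-bit : ∀ N n xs → All (Bounded bit N n) xs
All-bit N n []       = []
All-bit N n (x ∷ xs) = tt ∷ All-bit N n xs

input-bounded : ∀ x → Bounded Input (size (ParameterizedProblem.encode ISR x)) (Graph.order (ISRInstance.G x)) (input x)
input-bounded x =
    (n≤ , All.universal (λ r → n≤ , All-bit N n (toList r)) _)
  , (≤-trans (≤-reflexive (length-replicate d)) (≤-trans (ℕ≤size d) (≤-trans (size-left (encodeℕ d) c) (size-right g b)))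
    , All-bit N n (unary d))
  , (≤-trans (≤-reflexive (length-replicate k)) (≤-trans (ℕ≤size k) (≤-trans (size-left (encodeℕ k) a)
      (≤-trans (size-right (encodeℕ d) c) (size-right g b))))
    , All-bit N n (unary k))
  , (n≤ , All-bit N n (toList Iₛ))
  , (n≤ , All-bit N n (toList Iₜ))
  where
  open ISRInstance x
  g = encodeGraph G
  a = encodeSubset Iₛ ∙ encodeSubset Iₜ
  c = encodeℕ k ∙ a
  b = encodeℕ d ∙ c
  N = size (ParameterizedProblem.encode ISR x)
  n = Graph.order G
  n≤ : Graph.order G ≤ size (ParameterizedProblem.encode ISR x)
  n≤ = ≤-trans (length≤size encodeSubset (tabulate (Graph.neighbours G))) (size-left g b)

^-distribʳ-* : ∀ e m n → (m * n) ^ e ≡ m ^ e * n ^ e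
^-distribʳ-* zero    m n = refl
^-distribʳ-* (suc e) m n = trans (cong (m * n *_) (^-distribʳ-* e m n)) ([m*n]*[o*p]≡[m*o]*[n*p] m n (m ^ e) (n ^ e))

module Assemble (pre : Fun true (list bit) Tables) (main : Fun false (Input ⊗ Tables) bit) where

  -- `Tables` contains no `vec`, so its values are the same for every order; evaluating at order 0
  -- makes it visible that they depend on `p` alone.
  tables : ℕ → ⟪ Tables ⟫ 0
  tables p = ⟦ pre ⟧ 0 (unary p)

  answer : (x : ISRInstance) → Bool
  answer x = ⟦ main ⟧ (orderOf x) (input x , tables (parameterOf x))

  program : Program
  program = record
    { auxiliaries = 1
    ; body = stack ≔ cons V W ⨾ value ≔ tl V ⨾ code pre ⨾ value ≔ cons (hd (hd W)) V ⨾ code main }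

  private
    M : ℕ → ℕ
    M p = proj₁ (Bounded-exists Tables 0 (tables p))

    e : ℕ
    e = degree main

    f : ℕ → ℕ
    f p = 17 + time pre 0 (unary p) + (3 + M p) ^ e

  -- The bound `s + m` on input and tables together is turned into a product:
  -- `2 + (s + m) ≤ (3 + m) * s` because `s ≥ 1`, and powers distribute over products.
  arithmetic : ∀ {a b s} m → 1 ≤ s → b ≤ (2 + (s + m)) ^ e → a + b ≤ (a + (3 + m) ^ e) * s ^ e
  arithmetic {a} {b} {s} m 1≤s b≤ = begin
    a + b                              ≤⟨ +-mono-≤ (≤-trans (≤-reflexive (sym (*-identityʳ a))) (*-monoʳ-≤ a 1≤s^e)) b≤′ ⟩
    a * s ^ e + ((3 + m) * s) ^ e      ≡⟨ cong (a * s ^ e +_) (^-distribʳ-* e (3 + m) s) ⟩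
    a * s ^ e + (3 + m) ^ e * s ^ e    ≡⟨ sym (*-distribʳ-+ (s ^ e) a ((3 + m) ^ e)) ⟩
    (a + (3 + m) ^ e) * s ^ e          ∎
    where
    open ≤-Reasoning
    1≤s^e : 1 ≤ s ^ e
    1≤s^e = ≤-trans (≤-reflexive (sym (^-zeroˡ e))) (^-monoˡ-≤ e 1≤s)
    base : 2 + (s + m) ≤ (3 + m) * s
    base = begin
      2 + (s + m)          ≡⟨ +-comm 2 (s + m) ⟩
      s + m + 2            ≡⟨ +-assoc s m 2 ⟩
      s + (m + 2)          ≡⟨ cong (s +_) (+-comm m 2) ⟩
      s + (2 + m)          ≡⟨ cong (s +_) (sym (*-identityʳ (2 + m))) ⟩
      s + (2 + m) * 1      ≤⟨ +-monoʳ-≤ s (*-monoʳ-≤ (2 + m) 1≤s) ⟩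
      s + (2 + m) * s      ∎
    b≤′ : b ≤ ((3 + m) * s) ^ e
    b≤′ = ≤-trans b≤ (^-monoˡ-≤ e base)

  runs : ∀ x →
    Exec (Program.body program)
      ((enc Input (orderOf x) (input x) ∙ encodeList encodeBool (unary (parameterOf x))) ∷ nil ∷ [])
      (17 + time pre 0 (unary (parameterOf x)) + time main (orderOf x) (input x , tables (parameterOf x)))
      (encodeBool (answer x) ∷ ((enc Input (orderOf x) (input x) ∙ encodeList encodeBool (unary (parameterOf x))) ∙ nil) ∷ [])
  runs x = subst (λ t → Exec (Program.body program) (S ∷ nil ∷ []) t (encodeBool (answer x) ∷ (S ∙ nil) ∷ []))
    (cong (10 +_) (sum (time pre 0 q) (time main (orderOf x) (input x , tables (parameterOf x)))))
    (seq assign (seq assign (seq (run pre 0 q (S ∙ nil)) (seq assign (run main (orderOf x) (input x , tables (parameterOf x)) (S ∙ nil))))))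
    where
    q = unary (parameterOf x)
    S = enc Input (orderOf x) (input x) ∙ encodeList encodeBool q
    sum : ∀ t u → t + (7 + u) ≡ 7 + t + u
    sum t u = trans (sym (+-assoc t 7 u)) (cong (_+ u) (+-comm t 7))

  tractable : (∀ x → Reconfiguration.Path (ISRInstance.G x) (ISRInstance.k x) (ISRInstance.Iₛ x) (ISRInstance.Iₜ x) ⇔ answer x ≡ true) →
    FixedParameterTractable ISR
  tractable correct = program , f , e , λ x →
    let order = orderOf x
        p  = parameterOf x
        I  = enc Input order (input x)
        s  = size (ParameterizedProblem.encode ISR x)
        t₁ = time pre 0 (unary p)
        t₂ = time main order (input x , tables p)
    in 17 + t₁ + t₂ , encodeBool (answer x)
     , ( _ , subst₂ (λ i q → Exec (Program.body program) ((i ∙ q) ∷ nil ∷ []) (17 + t₁ + t₂) (encodeBool (answer x) ∷ ((i ∙ q) ∙ nil) ∷ []))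
                (encode-input x) (enc-unary p) (runs x) , refl)
     , arithmetic {17 + t₁} {t₂} {s} (M p) (size>0 (ParameterizedProblem.encode ISR x)) (Below.bound (time-≤ main (
          Bounded-mono Input {N = s + M p} (m≤m+n s (M p)) (input-bounded x) , Bounded-mono Tables {N = s + M p} {order} (m≤n+m (M p) s) (tables-bounded order p))))
     , mk⇔ (λ path → ≢nil (Equivalence.to (correct x) path)) (λ ≢ → Equivalence.from (correct x) (from≢ _ ≢))
    where
    from≢ : ∀ b → encodeBool b ≢ nil → b ≡ true
    from≢ false ne = ⊥-elim (ne refl)
    from≢ true  ne = refl
    ≢nil : ∀ {b} → b ≡ true → encodeBool b ≢ nil
    ≢nil refl ()
    tables-bounded : ∀ n p → Bounded Tables (M p) n (tables p)
    tables-bounded n p = proj₂ (Bounded-exists Tables 0 (tables p))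

-- The algorithm

-- A vertex as programs see it: its singleton and its neighbourhood. In the absence of indices,
-- membership is tested by meeting a set with the singleton.
Entry : Ty
Entry = vec bit ⊗ vec bit

-- Decodes one bit per element of `S`. A code thus needs as many bits as the kernel has vertices,
-- independently of the order of the graph, and can be tabulated beforehand.
spread : ∀ {m} → Subset m → List Bool → Subset m
spread []          l = []
spread (false ∷ S) l = false ∷ spread S l
spread (true  ∷ S) l = headBit l ∷ spread S (tail′ l)

module _ {c : Bool} where

  infixr 5 _&&_
  infixl 6 _∪F_ _∩F_ _─F_

  foldF : ∀ {g s x} → Fun c g (list x) → Fun c g s → Fun c ((g ⊗ s) ⊗ x) s → Fun c g s
  foldF xs i F = loopF F ∘F ⟨ ⟨ idF , i ⟩ , xs ⟩

  _&&_ : ∀ {g} → Fun c g bit → Fun c g bit → Fun c g bit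
  _&&_ {g} F G = by (ifF F G (bitF false)) (λ n x → ⟦ F ⟧ n x ∧ ⟦ G ⟧ n x) (λ n x → lemma (⟦ F ⟧ n x))
    where
    lemma : ∀ b {b′} → (if b then b′ else false) ≡ b ∧ b′
    lemma false = refl
    lemma true  = refl

  notF : ∀ {g} → Fun c g bit → Fun c g bit
  notF F = by (ifF F (bitF false) (bitF true)) (λ n x → not (⟦ F ⟧ n x)) (λ n x → lemma (⟦ F ⟧ n x))
    where
    lemma : ∀ b → (if b then false else true) ≡ not b
    lemma false = refl
    lemma true  = refl

  zipF : Fun c (bit ⊗ bit) bit → Fun c (vec bit ⊗ vec bit) (vec bit)
  zipF op = by (sndF ∘F scanF {a = bit} ⟨ tailF ∘F sndF ∘F fstF , op ∘F ⟨ sndF , headF ∘F sndF ∘F fstF ⟩ ⟩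
                 ∘F ⟨ ⟨ bitF false , listF ∘F sndF ⟩ , fstF ⟩)
               (λ n x → zipWith (λ p q → ⟦ op ⟧ n (p , q)) (proj₁ x) (proj₂ x)) (λ n x → lemma (proj₁ x) (proj₂ x))
    where
    lemma : ∀ {n m} (X Y : Vec Bool m) →
      proj₂ (scan (λ l p → tail′ l , ⟦ op ⟧ n (p , headBit l)) (toList Y) X) ≡ zipWith (λ p q → ⟦ op ⟧ n (p , q)) X Y
    lemma []      []      = refl
    lemma (p ∷ X) (q ∷ Y) = cong (_ ∷_) (lemma X Y)

  _∩F_ _∪F_ _─F_ : ∀ {g} → Fun c g (vec bit) → Fun c g (vec bit) → Fun c g (vec bit)
  _∩F_ F G = zipF (fstF && sndF) ∘F ⟨ F , G ⟩
  _∪F_ F G = zipF (by (ifF fstF (bitF true) sndF) (λ n x → proj₁ x ∨ proj₂ x) λ { n (false , q) → refl ; n (true , q) → refl }) ∘F ⟨ F , G ⟩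
  _─F_ F G = by (zipF (ifF sndF (bitF false) fstF) ∘F ⟨ F , G ⟩) (λ n x → ⟦ F ⟧ n x ─ ⟦ G ⟧ n x) (λ n x → lemma (⟦ F ⟧ n x) (⟦ G ⟧ n x))
    where
    lemma : ∀ {m} (X Y : Subset m) → zipWith (λ p q → if q then false else p) X Y ≡ X ─ Y
    lemma []      []          = refl
    lemma (p ∷ X) (false ∷ Y) = cong (p ∷_) (lemma X Y)
    lemma (p ∷ X) (true  ∷ Y) = cong (false ∷_) (lemma X Y)

  constF : ∀ {g} → Bool → Fun c g (vec bit) → Fun c g (vec bit)
  constF b F = by (sndF ∘F scanF {a = bit} {s = bit} ⟨ bitF b , bitF b ⟩ ∘F ⟨ ⟨ bitF b , bitF b ⟩ , F ⟩) (λ n _ → Data.Vec.replicate n b) (λ n x → lemma (⟦ F ⟧ n x))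
    where
    lemma : ∀ {m} (X : Vec Bool m) → proj₂ (scan (λ s _ → b , b) b X) ≡ Data.Vec.replicate m b
    lemma []      = refl
    lemma (_ ∷ X) = cong (b ∷_) (lemma X)

  someF : Fun c (vec bit) bit
  someF = by (foldF listF (bitF false) (ifF sndF (bitF true) (sndF ∘F fstF))) (λ n X → does (nonempty? X)) (λ n X → lemma X)
    where
    f : Bool → Bool → Bool
    f s b = if b then true else s
    stays : ∀ bs → foldl f true bs ≡ true
    stays []           = refl
    stays (false ∷ bs) = stays bs
    stays (true  ∷ bs) = stays bs
    found : ∀ {m x} {X : Subset m} → x ∈ X → foldl f false (toList X) ≡ true
    found (Data.Vec.here {xs = X}) = stays (toList X)
    found (Data.Vec.there {y = false} x∈X) = found x∈X
    found (Data.Vec.there {y = true} {xs = X} x∈X) = stays (toList X)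
    absent : ∀ {m} (X : Subset m) → ¬ Nonempty X → foldl f false (toList X) ≡ false
    absent []          e = refl
    absent (false ∷ X) e = absent X λ (x , x∈) → e (suc x , Data.Vec.there x∈)
    absent (true  ∷ X) e = contradiction (zero , Data.Vec.here) e
    lemma : ∀ {m} (X : Subset m) → foldl f false (toList X) ≡ does (nonempty? X)
    lemma X with nonempty? X
    ... | yes (x , x∈) = found x∈
    ... | no  e        = absent X e

  meetsF : ∀ {g} → Fun c g (vec bit) → Fun c g (vec bit) → Fun c g bit
  meetsF F G = someF ∘F (F ∩F G)

  -- A cardinality cannot be counted up without `consF`; instead it is compared with a given unary
  -- number by discarding one entry per element.
  dropF : ∀ {g a} → Fun c g (vec bit) → Fun c g (list a) → Fun c g (list a)
  dropF F G = by (foldF (listF ∘F F) G (ifF sndF (tailF ∘F sndF ∘F fstF) (sndF ∘F fstF)))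
    (λ n x → drop ∣ ⟦ F ⟧ n x ∣ (⟦ G ⟧ n x)) (λ n x → lemma (⟦ F ⟧ n x) (⟦ G ⟧ n x))
    where
    lemma : ∀ {A : Set} {m} (X : Subset m) (l : List A) → foldl (λ s b → if b then tail′ s else s) l (toList X) ≡ drop ∣ X ∣ l
    lemma []          l       = refl
    lemma (false ∷ X) l       = lemma X l
    lemma (true  ∷ X) []      = trans (lemma X []) (drop-[] ∣ X ∣)
      where
      drop-[] : ∀ {A : Set} m → drop {A = A} m [] ≡ []
      drop-[] zero    = refl
      drop-[] (suc m) = refl
    lemma (true  ∷ X) (_ ∷ l) = lemma X l

  lessF : ∀ {g a} → Fun c g (vec bit) → Fun c g (list a) → Fun c g bit
  lessF F G = by (nonemptyF ∘F dropF F G) (λ n x → does (∣ ⟦ F ⟧ n x ∣ <? length (⟦ G ⟧ n x))) (λ n x → lemma ∣ ⟦ F ⟧ n x ∣ (⟦ G ⟧ n x))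
    where
    lemma : ∀ {A : Set} m (l : List A) → nonempty (drop m l) ≡ does (m <? length l)
    lemma zero    []      = refl
    lemma zero    (_ ∷ _) = refl
    lemma (suc m) []      = refl
    lemma (suc m) (_ ∷ l) = lemma m l

  -- An empty remainder does not tell equality from excess, so a flag records whether some element
  -- found the list exhausted.
  fitsF : ∀ {g a} → Fun c g (vec bit) → Fun c g (list a) → Fun c g bit
  fitsF {a = a} F G = by
    (sndF ∘F foldF (listF ∘F F) ⟨ G , bitF true ⟩
      (ifF sndF ⟨ tailF ∘F fstF ∘F sndF ∘F fstF , ifF (nonemptyF ∘F fstF ∘F sndF ∘F fstF) (sndF ∘F sndF ∘F fstF) (bitF false) ⟩ (sndF ∘F fstF)))
    (λ n x → does (∣ ⟦ F ⟧ n x ∣ ≤? length (⟦ G ⟧ n x))) (λ n x → lemma (⟦ F ⟧ n x) (⟦ G ⟧ n x))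
    where
    f : {A : Set} → List A × Bool → Bool → List A × Bool
    f s b = if b then (tail′ (proj₁ s) , (if nonempty (proj₁ s) then proj₂ s else false)) else s
    stays : ∀ {A : Set} (l : List A) bs → proj₂ (foldl f (l , false) bs) ≡ false
    stays l       []           = refl
    stays l       (false ∷ bs) = stays l bs
    stays []      (true ∷ bs)  = stays [] bs
    stays (_ ∷ l) (true ∷ bs)  = stays l bs
    lemma : ∀ {A : Set} {m} (X : Subset m) (l : List A) → proj₂ (foldl f (l , true) (toList X)) ≡ does (∣ X ∣ ≤? length l)
    lemma []          l       = refl
    lemma (false ∷ X) l       = lemma X l
    lemma (true  ∷ X) []      = stays [] (toList X)
    lemma (true  ∷ X) (_ ∷ l) = trans (lemma X l) (does-⇔ (mk⇔ s≤s s≤s⁻¹) (∣ X ∣ ≤? length l) (suc ∣ X ∣ ≤? suc (length l)))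

  symDiffF : ∀ {g} → Fun c g (vec bit) → Fun c g (vec bit) → Fun c g (vec bit)
  symDiffF F G = (F ─F G) ∪F (G ─F F)

  spreadF : ∀ {g} → Fun c g (vec bit) → Fun c g (list bit) → Fun c g (vec bit)
  spreadF F G = by
    (sndF ∘F scanF {a = bit} (ifF sndF ⟨ tailF ∘F sndF ∘F fstF , headF ∘F sndF ∘F fstF ⟩ ⟨ sndF ∘F fstF , bitF false ⟩)
      ∘F ⟨ ⟨ bitF false , G ⟩ , F ⟩)
    (λ n x → spread (⟦ F ⟧ n x) (⟦ G ⟧ n x)) (λ n x → lemma (⟦ F ⟧ n x) (⟦ G ⟧ n x))
    where
    lemma : ∀ {m} (X : Subset m) (l : List Bool) →
      proj₂ (scan (λ l b → if b then (tail′ l , headBit l) else (l , false)) l X) ≡ spread X l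
    lemma []          l = refl
    lemma (false ∷ X) l = cong (false ∷_) (lemma X l)
    lemma (true  ∷ X) l = cong (headBit l ∷_) (lemma X (tail′ l))

  -- Singletons are one-hot vectors: `firstF` produces the first, and each row passes it on shifted
  -- by one place.
  entriesF : Fun c (vec (vec bit)) (vec Entry)
  entriesF = by
    (sndF ∘F scanF {a = bit} ⟨ shiftF ∘F sndF ∘F fstF , ⟨ sndF ∘F fstF , sndF ⟩ ⟩ ∘F ⟨ ⟨ bitF false , firstF ⟩ , idF ⟩)
    (λ n R → tabulate (λ i → ⁅ i ⁆ , lookup R i)) (λ n R → lemma R)
    where
    shiftF : Fun c (vec bit) (vec bit)
    shiftF = sndF ∘F scanF {a = bit} ⟨ sndF , sndF ∘F fstF ⟩ ∘F ⟨ ⟨ bitF false , bitF false ⟩ , idF ⟩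
    firstF : Fun c (vec (vec bit)) (vec bit)
    firstF = sndF ∘F scanF {a = bit} ⟨ bitF true , notF (sndF ∘F fstF) ⟩ ∘F ⟨ ⟨ bitF false , bitF false ⟩ , idF ⟩
    hot : ℕ → ∀ m → Subset m
    hot j       zero    = []
    hot zero    (suc m) = true ∷ ∅
    hot (suc j) (suc m) = false ∷ hot j m
    shift : ∀ {m} → Bool → Subset m → Subset m
    shift b X = proj₂ (scan (λ s b → b , s) b X)
    shift-∅ : ∀ m → shift {m} false ∅ ≡ ∅
    shift-∅ zero    = refl
    shift-∅ (suc m) = cong (false ∷_) (shift-∅ m)
    shift-hot : ∀ j m → shift false (hot j m) ≡ hot (suc j) m
    shift-hot j       zero          = refl
    shift-hot zero    (suc zero)    = refl
    shift-hot zero    (suc (suc m)) = cong (λ X → false ∷ true ∷ X) (shift-∅ m)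
    shift-hot (suc j) (suc m)       = cong (false ∷_) (shift-hot j m)
    first-hot : ∀ {A : Set} {m} (R : Vec A m) → proj₂ (scan (λ s _ → true , not s) false R) ≡ hot 0 m
    first-hot []      = refl
    first-hot (_ ∷ R) = cong (true ∷_) (rest R)
      where
      rest : ∀ {A : Set} {m} (R : Vec A m) → proj₂ (scan (λ s _ → true , not s) true R) ≡ ∅
      rest []      = refl
      rest (_ ∷ R) = cong (false ∷_) (rest R)
    hot-⁅⁆ : ∀ {m} (i : Fin m) → hot (toℕ i) m ≡ ⁅ i ⁆
    hot-⁅⁆ zero    = refl
    hot-⁅⁆ (suc i) = cong (false ∷_) (hot-⁅⁆ i)
    rows : ∀ {A : Set} n {m} (R : Vec A m) j →
      proj₂ (scan (λ s r → shift false s , (s , r)) (hot j n) R) ≡ tabulate (λ i → hot (j + toℕ i) n , lookup R i)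
    rows n []      j = refl
    rows n (r ∷ R) j = cong₂ _∷_ (cong (λ k → hot k n , r) (sym (+-identityʳ j))) (begin
      proj₂ (scan (λ s r → shift false s , (s , r)) (shift false (hot j n)) R)
        ≡⟨ cong (λ h → proj₂ (scan (λ s r → shift false s , (s , r)) h R)) (shift-hot j n) ⟩
      proj₂ (scan (λ s r → shift false s , (s , r)) (hot (suc j) n) R)
        ≡⟨ rows n R (suc j) ⟩
      tabulate (λ i → hot (suc j + toℕ i) n , lookup R i)
        ≡⟨ Vec.tabulate-cong (λ i → cong (λ k → hot k n , lookup R i) (sym (+-suc j (toℕ i)))) ⟩
      tabulate (λ i → hot (j + suc (toℕ i)) n , lookup R i) ∎)
      where open ≡-Reasoning
    lemma : ∀ {A : Set} {n} (R : Vec A n) →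
      proj₂ (scan (λ s r → shift false s , (s , r)) (proj₂ (scan (λ s _ → true , not s) false R)) R)
        ≡ tabulate (λ i → ⁅ i ⁆ , lookup R i)
    lemma {n = n} R rewrite first-hot R =
      trans (rows n R 0) (Vec.tabulate-cong (λ i → cong (_, lookup R i) (hot-⁅⁆ i)))

  forEachF : ∀ {g s} → Fun c g (vec (vec bit)) → Fun c g s → Fun c ((g ⊗ s) ⊗ Entry) s → Fun c g s
  forEachF R I F = by (foldF (listF ∘F entriesF ∘F R) I F)
    (λ n x → foldl (λ s i → ⟦ F ⟧ n ((x , s) , (⁅ i ⁆ , lookup (⟦ R ⟧ n x) i))) (⟦ I ⟧ n x) (allFin n))
    (λ n x → foldl-tabulate (λ s y → ⟦ F ⟧ n ((x , s) , y)) (λ i → ⁅ i ⁆ , lookup (⟦ R ⟧ n x) i))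
    where
    toList-tabulate : ∀ {A : Set} {m} (h : Fin m → A) → toList (tabulate h) ≡ Data.List.tabulate h
    toList-tabulate {m = zero}  h = refl
    toList-tabulate {m = suc m} h = cong (h zero ∷_) (toList-tabulate (h ∘ suc))
    foldl-tabulate : ∀ {A S : Set} {m} (f : S → A → S) (h : Fin m → A) {s} →
      foldl f s (toList (tabulate h)) ≡ foldl (λ s i → f s (h i)) s (allFin m)
    foldl-tabulate f h {s} =
      trans (cong (foldl f s) (trans (toList-tabulate h) (sym (List.map-tabulate id h)))) (List.foldl-map f h s (allFin _))

module Algorithm {n : ℕ} (N : Fin n → Subset n) where

  closed : Fin n → Subset n
  closed i = ⁅ i ⁆ ∪ N i

  -- Phrased through intersections so that its decision procedure unfolds to the very test made by
  -- `redundantF`. `H` is the union of the petals chosen so far, each without its part in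
  -- `closed u`.
  Candidate : ℕ → Subset n → Fin n → Subset n → Fin n → Set
  Candidate D S u H x =
    Nonempty (⁅ x ⁆ ∩ S) × ¬ Nonempty (⁅ x ⁆ ∩ ⁅ u ⁆) × ∣ N x ∩ S ∣ < D × ¬ Nonempty (closed x ∩ H)

  candidate? : ∀ D S u H x → Dec (Candidate D S u H x)
  candidate? D S u H x =
    nonempty? (⁅ x ⁆ ∩ S) ×-dec ¬? (nonempty? (⁅ x ⁆ ∩ ⁅ u ⁆)) ×-dec ∣ N x ∩ S ∣ <? D ×-dec ¬? (nonempty? (closed x ∩ H))

  collect : ℕ → Subset n → Fin n → Subset n × List Bool → Fin n → Subset n × List Bool
  collect D S u s x =
    if does (candidate? D S u (proj₁ s) x)
    then (proj₁ s ∪ ((closed x ∩ S) ─ closed u) , tail′ (proj₂ s))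
    else s

  redundant : ℕ → List Bool → Subset n → Fin n → Bool
  redundant D P S u = not (nonempty (proj₂ (foldl (collect D S u) (∅ , P) (allFin n))))

  independent : Subset n → Bool
  independent A = foldl (λ b i → b ∧ not (does (nonempty? (⁅ i ⁆ ∩ A)) ∧ does (nonempty? (N i ∩ A)))) true (allFin n)

  node : List Bool → Subset n → Bool
  -- Size `k` or `k − 1`: after `∣ A ∣` of the `k` entries are dropped, at most one is left.
  node k A = independent A ∧ does (∣ A ∣ ≤? length k) ∧ not (nonempty (tail′ (drop ∣ A ∣ k)))

  -- Targets that are not adjacent to A are skipped, so every sequence of targets
  -- yields a walk.
  move : List Bool → List Bool → Subset n → Subset n → Subset n
  move k one A B = if node k B ∧ does (∣ A △ B ∣ ≤? length one) then B else A

  module _ (I J : Subset n) where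

    prune : ℕ → List Bool → Subset n → Fin n → Subset n
    prune D P S u =
      if does (nonempty? (⁅ u ⁆ ∩ S)) ∧ not (does (nonempty? (⁅ u ⁆ ∩ I))) ∧ not (does (nonempty? (⁅ u ⁆ ∩ J)))
         ∧ redundant D P S u
      then S ─ ⁅ u ⁆ else S

    pass : ℕ → List Bool → Subset n → Subset n
    pass D P S = foldl (prune D P) S (allFin n)

    -- A deletion may change which vertices are redundant, so passes are repeated. A pass that
    -- changes anything deletes a vertex, hence one pass per vertex reaches a fixed point.
    kernel : ℕ → List Bool → Subset n
    kernel D P = foldl (λ S _ → pass D P S) full (allFin n)

    search : List Bool → List Bool → Subset n → List (List (List Bool)) → Bool
    search k one S =
      foldl (λ b qs → if b then true else
        not (does (nonempty? (foldl (λ A q → move k one A (spread S q)) I qs △ J)))) false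

module _ {c : Bool} where

  infixl 10 _↑
  _↑ : ∀ {g s x a} → Fun c g a → Fun c ((g ⊗ s) ⊗ x) a
  F ↑ = F ∘F fstF ∘F fstF

  stateF : ∀ {g s x} → Fun c ((g ⊗ s) ⊗ x) s
  stateF = sndF ∘F fstF

  closedF : ∀ {g} → Fun c g Entry → Fun c g (vec bit)
  closedF U = (fstF ∘F U) ∪F (sndF ∘F U)

  redundantF : ∀ {g} → Fun c g (vec (vec bit)) → Fun c g (list bit) → Fun c g (list bit) → Fun c g (vec bit) → Fun c g Entry → Fun c g bit
  redundantF R D P S U = notF (nonemptyF ∘F sndF ∘F
    forEachF R ⟨ constF false S , P ⟩
      (ifF (meetsF e (S ↑) && notF (meetsF e (fstF ∘F U ↑)) && lessF ((sndF ∘F sndF) ∩F (S ↑)) (D ↑) && notF (meetsF (closedF sndF) (fstF ∘F stateF)))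
        ⟨ (fstF ∘F stateF) ∪F ((closedF sndF ∩F (S ↑)) ─F closedF (U ↑)) , tailF ∘F sndF ∘F stateF ⟩
        stateF))
    where
    e : ∀ {h} → Fun c (h ⊗ Entry) (vec bit)
    e = fstF ∘F sndF

  nodeF : ∀ {g} → Fun c g (vec (vec bit)) → Fun c g (list bit) → Fun c g (vec bit) → Fun c g bit
  nodeF R K A =
       forEachF R (bitF true) (stateF && notF (meetsF (fstF ∘F sndF) (A ↑) && meetsF (sndF ∘F sndF) (A ↑)))
    && fitsF A K && notF (nonemptyF ∘F tailF ∘F dropF A K)

  moveF : ∀ {g} → Fun c g (vec (vec bit)) → Fun c g (list bit) → Fun c g (list bit) → Fun c g (vec bit) → Fun c g (vec bit) → Fun c g (vec bit)
  moveF R K O A B = ifF (nodeF R K B && fitsF (symDiffF A B) O) B A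

  kernelF : ∀ {g} → Fun c g (vec (vec bit)) → Fun c g (list bit) → Fun c g (list bit) → Fun c g (vec bit) → Fun c g (vec bit) → Fun c g (vec bit)
  kernelF R D P I J =
    forEachF R (constF true I)
      (forEachF (R ↑) stateF
        (ifF (meetsF (fstF ∘F sndF) stateF && notF (meetsF (fstF ∘F sndF) (I ↑ ↑)) && notF (meetsF (fstF ∘F sndF) (J ↑ ↑))
              && redundantF (R ↑ ↑) (D ↑ ↑) (P ↑ ↑) stateF sndF)
          (stateF ─F (fstF ∘F sndF)) stateF))

  searchF : ∀ {g} → Fun c g (vec (vec bit)) → Fun c g (list bit) → Fun c g (list bit) → Fun c g (list (list (list bit))) →
    Fun c g (vec bit) → Fun c g (vec bit) → Fun c g (vec bit) → Fun c g bit
  searchF R K O Qs I J S =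
    foldF Qs (bitF false)
      (ifF stateF (bitF true)
        (notF (someF ∘F symDiffF
          (foldF sndF (I ↑) (moveF (R ↑ ↑) (K ↑ ↑) (O ↑ ↑) stateF (spreadF (S ↑ ↑) sndF)))
          (J ↑))))

mainF : Fun false (Input ⊗ Tables) bit
mainF = searchF (R ∘F fstF) (K ∘F fstF) (O ∘F fstF) (Qs ∘F fstF) (I ∘F fstF) (J ∘F fstF) sndF ∘F ⟨ idF , kernelF R D P I J ⟩
  where
  R  = fstF ∘F fstF
  K  = fstF ∘F sndF ∘F sndF ∘F fstF
  I  = fstF ∘F sndF ∘F sndF ∘F sndF ∘F fstF
  J  = sndF ∘F sndF ∘F sndF ∘F sndF ∘F fstF
  P  = fstF ∘F sndF
  D  = fstF ∘F sndF ∘F sndF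
  O  = fstF ∘F sndF ∘F sndF ∘F sndF
  Qs = sndF ∘F sndF ∘F sndF ∘F sndF ∘F sndF

-- Definitional, because `by` gives the combinators the meanings used in `Algorithm`.
mainF-computes : ∀ n R d k I J P D O Q Qs →
  ⟦ mainF ⟧ n ((R , d , k , I , J) , (P , D , O , Q , Qs))
    ≡ Algorithm.search (lookup R) I J k O (Algorithm.kernel (lookup R) I J (length D) P) Qs
mainF-computes n R d k I J P D O Q Qs = refl

-- Precomputation of the tables

module _ {A : Set} where

  prepend : List A → List A → List (List A) → List (List A)
  prepend X s out = foldl (λ out x → (x ∷ s) ∷ out) out X

  extendAll : List A → List (List A) → List (List A)
  extendAll X acc = foldl (λ out s → prepend X s out) [] acc

  -- `Y` serves as a length in unary. Besides enumerating, this exponentiates: the result has length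
  -- `length X ^ length Y`.
  sequences : {B : Set} → List A → List B → List (List A)
  sequences X Y = foldl (λ acc _ → extendAll X acc) ([] ∷ []) Y

  length-sequences : {B : Set} (X : List A) (Y : List B) → length (sequences X Y) ≡ length X ^ length Y
  length-sequences X Y = trans (outer Y _) (*-identityˡ _)
    where
    inner : ∀ X s out → length (prepend X s out) ≡ length X + length out
    inner []      s out = refl
    inner (x ∷ X) s out = trans (inner X s _) (+-suc _ _)
    middle : ∀ acc out → length (foldl (λ out s → prepend X s out) out acc) ≡ length acc * length X + length out
    middle []        out = refl
    middle (s ∷ acc) out = begin
      length (foldl (λ out s → prepend X s out) (prepend X s out) acc)  ≡⟨ middle acc (prepend X s out) ⟩
      length acc * length X + length (prepend X s out)      ≡⟨ cong (length acc * length X +_) (inner X s out) ⟩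
      length acc * length X + (length X + length out)       ≡⟨ sym (+-assoc (length acc * length X) _ _) ⟩
      length acc * length X + length X + length out         ≡⟨ cong (_+ length out) (+-comm (length acc * length X) _) ⟩
      length X + length acc * length X + length out         ∎
      where open ≡-Reasoning
    outer : ∀ {B : Set} (Y : List B) acc → length (foldl (λ acc _ → extendAll X acc) acc Y) ≡ length acc * length X ^ length Y
    outer []      acc = sym (*-identityʳ _)
    outer (_ ∷ Y) acc = begin
      length (foldl (λ acc _ → extendAll X acc) (extendAll X acc) Y)  ≡⟨ outer Y _ ⟩
      length (extendAll X acc) * length X ^ length Y  ≡⟨ cong (_* length X ^ length Y) (trans (middle acc []) (+-identityʳ _)) ⟩
      length acc * length X * length X ^ length Y     ≡⟨ *-assoc (length acc) _ _ ⟩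
      length acc * (length X * length X ^ length Y)   ∎
      where open ≡-Reasoning

  ∈-sequences : {B : Set} (X : List A) (Y : List B) → ∀ {qs} → All (_∈ₗ X) qs → length qs ≡ length Y → qs ∈ₗ sequences X Y
  ∈-sequences X Y {qs} qs∈ eq =
    -- Each round prepends its element, so the elements of `qs` must be supplied last to first.
    subst (_∈ₗ sequences X Y) (List.reverse-involutive qs)
      (outer Y (sym (trans (List.length-reverse qs) eq)) (reversed qs∈ []) (here refl))
    where
    reversed : ∀ {P : A → Set} {xs ys} → All P xs → All P ys → All P (xs ʳ++ ys)
    reversed []       qs = qs
    reversed (p ∷ ps) qs = reversed ps (p ∷ qs)
    inner-keep : ∀ X {t s out} → t ∈ₗ out → t ∈ₗ prepend X s out
    inner-keep []      p = p
    inner-keep (x ∷ X) p = inner-keep X (there p)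
    inner : ∀ {X x s out} → x ∈ₗ X → (x ∷ s) ∈ₗ prepend X s out
    inner {X = x ∷ X} (here refl) = inner-keep X (here refl)
    inner             (there p)   = inner p
    middle-keep : ∀ acc {t out} → t ∈ₗ out → t ∈ₗ foldl (λ out s → prepend X s out) out acc
    middle-keep []        p = p
    middle-keep (s ∷ acc) p = middle-keep acc (inner-keep X p)
    middle : ∀ {acc x s out} → x ∈ₗ X → s ∈ₗ acc → (x ∷ s) ∈ₗ foldl (λ out s → prepend X s out) out acc
    middle {s ∷ acc} p (here refl) = middle-keep acc (inner p)
    middle           p (there q)   = middle p q
    outer : ∀ {B : Set} (Y : List B) {rs s acc} → length Y ≡ length rs → All (_∈ₗ X) rs → s ∈ₗ acc → (rs ʳ++ s) ∈ₗ foldl (λ acc _ → extendAll X acc) acc Y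
    outer []      {[]}     eq []       q = q
    outer (_ ∷ Y) {r ∷ rs} eq (p ∷ ps) q = outer Y (suc-injective eq) ps (middle p q)

seqsF : ∀ {g a b} → Fun true g (list a) → Fun true g (list b) → Fun true g (list (list a))
seqsF X Y = foldF Y (consF refl ∘F ⟨ nilF , nilF ⟩)
  (foldF stateF nilF
    (foldF (X ↑ ↑) stateF
      (consF refl ∘F ⟨ consF refl ∘F ⟨ sndF , sndF ∘F fstF ∘F fstF ⟩ , stateF ⟩)))

twice : {A : Set} → List Bool → List A → List Bool
twice l X = foldl (λ s _ → false ∷ false ∷ s) l X

length-twice : {A : Set} (l : List Bool) (X : List A) → length (twice l X) ≡ length X * 2 + length l
length-twice l []      = refl
length-twice l (x ∷ X) = trans (length-twice _ X) (trans (+-suc _ _) (cong suc (+-suc _ _)))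

tickF : ∀ {g} → Fun true g (list bit) → Fun true g (list bit)
tickF F = consF refl ∘F ⟨ bitF false , F ⟩

twiceF : ∀ {g a} → Fun true g (list bit) → Fun true g (list a) → Fun true g (list bit)
twiceF L X = foldF X L (tickF (tickF stateF))

-- Lists of lengths D = 2p + 1 and 2D + 4.
degreeTable exponentTable : ℕ → List Bool
degreeTable   p = twice (unary 1) (unary p)
exponentTable p = twice (unary 4) (degreeTable p)

-- Only its length `D ^ (2D + 4)` matters, as the number of bits in a code.
kernelTable : ℕ → List (List Bool)
kernelTable p = sequences (degreeTable p) (exponentTable p)

codeTable : ℕ → List (List Bool)
codeTable p = sequences (false ∷ true ∷ []) (kernelTable p)

preF : Fun true (list bit) Tables
preF = ⟨ tickF idF , ⟨ D , ⟨ O , ⟨ Q , seqsF Q Q ⟩ ⟩ ⟩ ⟩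
  where
  O D E : Fun true (list bit) (list bit)
  O = tickF nilF
  D = twiceF O idF
  E = twiceF (tickF (tickF (tickF O))) D
  Q = seqsF (tickF (consF refl ∘F ⟨ bitF true , nilF ⟩)) (seqsF D E)

-- The exchange argument

infixl 8 _⊞_ _⊟_

-- Updates at a position, in place of union and difference, make adding, removing and swapping
-- tokens obey equations between vectors.
_⊞_ _⊟_ : ∀ {n} → Subset n → Fin n → Subset n
A ⊞ u = A [ u ]≔ inside
A ⊟ u = A [ u ]≔ outside

module _ {n : ℕ} {A : Subset n} where

  ∈⊞⁻ : ∀ {u x} → x ∈ A ⊞ u → x ≡ u ⊎ x ∈ A
  ∈⊞⁻ {u} {x} p with x Fin.≟ u
  ... | yes x≡u = inj₁ x≡u
  ... | no  x≢u = inj₂ (Vec.lookup⇒[]= x A (trans (sym (Vec.lookup∘update′ x≢u A inside)) (Vec.[]=⇒lookup p)))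

  ∈⊞ : ∀ {u} → u ∈ A ⊞ u
  ∈⊞ {u} = Vec.lookup⇒[]= u (A ⊞ u) (Vec.lookup∘update u A inside)

  ⊆⊞ : ∀ {u} → A ⊆ A ⊞ u
  ⊆⊞ {u} {x} p with x Fin.≟ u
  ... | yes refl = ∈⊞
  ... | no  x≢u  = Vec.lookup⇒[]= x (A ⊞ u) (trans (Vec.lookup∘update′ x≢u A inside) (Vec.[]=⇒lookup p))

  ∈⊟⁻ : ∀ {u x} → x ∈ A ⊟ u → x ∈ A × x ≢ u
  ∈⊟⁻ {u} {x} p with x Fin.≟ u
  ... | yes refl = case trans (sym (Vec.lookup∘update x A outside)) (Vec.[]=⇒lookup p) of λ ()
  ... | no  x≢u  = Vec.lookup⇒[]= x A (trans (sym (Vec.lookup∘update′ x≢u A outside)) (Vec.[]=⇒lookup p)) , x≢u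

  ∈⊟⁺ : ∀ {u x} → x ∈ A → x ≢ u → x ∈ A ⊟ u
  ∈⊟⁺ {u} {x} p x≢u = Vec.lookup⇒[]= x (A ⊟ u) (trans (Vec.lookup∘update′ x≢u A outside) (Vec.[]=⇒lookup p))

∣⊞∣ : ∀ {n} {A : Subset n} {u} → u ∉ A → ∣ A ⊞ u ∣ ≡ suc ∣ A ∣
∣⊞∣ {A = true  ∷ A} {zero}  u∉ = contradiction Data.Vec.here u∉
∣⊞∣ {A = false ∷ A} {zero}  u∉ = refl
∣⊞∣ {A = true  ∷ A} {suc u} u∉ = cong suc (∣⊞∣ (u∉ ∘ Data.Vec.there))
∣⊞∣ {A = false ∷ A} {suc u} u∉ = ∣⊞∣ (u∉ ∘ Data.Vec.there)

⊟⊞ : ∀ {n} {A : Subset n} {u} → u ∈ A → A ⊟ u ⊞ u ≡ A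
⊟⊞ {A = A} {u} u∈A = trans (Vec.[]≔-idempotent A u) (trans (cong (A [ u ]≔_) (sym (Vec.[]=⇒lookup u∈A))) (Vec.[]≔-lookup A u))

⊞⊟ : ∀ {n} {A : Subset n} {u} → u ∉ A → A ⊞ u ⊟ u ≡ A
⊞⊟ {A = A} {u} u∉A = trans (Vec.[]≔-idempotent A u) (trans (cong (A [ u ]≔_) (sym lookup≡)) (Vec.[]≔-lookup A u))
  where
  lookup≡ : lookup A u ≡ outside
  lookup≡ with lookup A u in eq
  ... | true  = contradiction (Vec.lookup⇒[]= u A eq) u∉A
  ... | false = refl

module Tokens {n : ℕ} (N : Fin n → Subset n) (irreflexive : ∀ {u} → u ∉ N u) (symmetric : ∀ {u v} → v ∈ N u → u ∈ N v) (k′ : ℕ) where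

  Indep : Subset n → Set
  Indep A = ∀ {u v} → u ∈ A → v ∈ A → v ∉ N u

  -- An edge of the reconfiguration graph for `k = suc k′`, read from its smaller to its larger end.
  -- Independence and containment in `S`, imposed on the larger end, pass to the smaller.
  Add : Subset n → Subset n → Subset n → Set
  Add S A B = ∃[ u ] (u ∉ A × B ≡ A ⊞ u × ∣ A ∣ ≡ k′ × Indep B × B ⊆ S)

  Step : Subset n → Subset n → Subset n → Set
  Step S A B = Add S A B ⊎ Add S B A

  Path : Subset n → Subset n → Subset n → Set
  Path S = Star (Step S)

  Far : Fin n → Subset n → Set
  Far w T = ∀ {x} → x ∈ T → x ≢ w × x ∉ N w

  -- `T` stands for the other tokens while `v` carries one, plus vertices that the substitute must
  -- leave free. The bound is `suc k′` because, when a removal precedes an addition, `w` has to stay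
  -- clear of the vertex to be removed, of `k′ − 1` further tokens and of the vertex to be added.
  Replaceable : Subset n → Fin n → Set
  Replaceable S v = ∀ T → T ⊆ S → ∣ T ∣ ≤ suc k′ → Far v T → ∃[ w ] (w ∈ S × w ≢ v × Far w T)

  module Exchange {S S′ J : Subset n} {v : Fin n} (replace : Replaceable S v)
    (v∉J : v ∉ J) (S-v⊆S′ : ∀ {x} → x ∈ S → x ≢ v → x ∈ S′) where

    Good : Fin n → Subset n → Set
    Good w T = w ∈ S × w ≢ v × Far w T

    indep-⊞ : ∀ {X w} → Indep X → Far w X → Indep (X ⊞ w)
    indep-⊞ iX far p q r with ∈⊞⁻ p | ∈⊞⁻ q
    ... | inj₁ refl | inj₁ refl = irreflexive r
    ... | inj₁ refl | inj₂ q    = proj₂ (far q) r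
    ... | inj₂ p    | inj₁ refl = proj₂ (far p) (symmetric r)
    ... | inj₂ p    | inj₂ q    = iX p q r

    far-⊆ : ∀ {w X T} → X ⊆ T → Far w T → Far w X
    far-⊆ X⊆T far p = far (X⊆T p)

    indep-⊆ : ∀ {A B} → A ⊆ B → Indep B → Indep A
    indep-⊆ A⊆B iB p q = iB (A⊆B p) (A⊆B q)

    ⊆S′ : ∀ {A} → A ⊆ S → v ∉ A → A ⊆ S′
    ⊆S′ {A} A⊆S v∉A p = S-v⊆S′ (A⊆S p) λ x≡v → v∉A (subst (_∈ A) x≡v p)

    ⊞⊆S′ : ∀ {X w} → X ⊆ S′ → w ∈ S → w ≢ v → X ⊞ w ⊆ S′
    ⊞⊆S′ X⊆ w∈ w≢ p with ∈⊞⁻ p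
    ... | inj₁ refl = S-v⊆S′ w∈ w≢
    ... | inj₂ q    = X⊆ q

    add-good : ∀ {X w} → ∣ X ∣ ≡ k′ → Indep X → X ⊆ S → v ∉ X → Good w X → Add S′ X (X ⊞ w)
    add-good eq iX X⊆S v∉X (w∈ , w≢ , far) =
      _ , (λ w∈X → proj₁ (far w∈X) refl) , refl , eq , indep-⊞ iX far , ⊞⊆S′ (⊆S′ X⊆S v∉X) w∈ w≢

    swap : Subset n → Fin n → Subset n
    swap A w = A ⊟ v ⊞ w

    v∉⊟ : ∀ {A} → v ∉ A ⊟ v
    v∉⊟ p = proj₂ (∈⊟⁻ p) refl

    ⊟⊆ : ∀ {A : Subset n} → A ⊟ v ⊆ A
    ⊟⊆ p = proj₁ (∈⊟⁻ p)

    ∣⊟∣ : ∀ {A} → v ∈ A → suc ∣ A ⊟ v ∣ ≡ ∣ A ∣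
    ∣⊟∣ {A} v∈A = trans (sym (∣⊞∣ (v∉⊟ {A}))) (cong ∣_∣ (⊟⊞ v∈A))

    ∣swap∣ : ∀ {A w} → v ∈ A → w ∉ A ⊟ v → ∣ swap A w ∣ ≡ ∣ A ∣
    ∣swap∣ v∈A w∉ = trans (∣⊞∣ w∉) (∣⊟∣ v∈A)

    add-swapped : ∀ {A u w} → v ∈ A → u ∉ A → ∣ A ∣ ≡ k′ → Indep (A ⊞ u) → A ⊞ u ⊆ S →
      Good w ((A ⊞ u) ⊟ v) → Add S′ (swap A w) (swap (A ⊞ u) w)
    add-swapped {A} {u} {w} v∈A u∉A eq iB B⊆S (w∈ , w≢ , far) =
      u , u∉ , swap-⊞ , trans (∣swap∣ v∈A (λ p → proj₁ (far (∈⊟⁺ (⊆⊞ (⊟⊆ p)) (proj₂ (∈⊟⁻ p)))) refl)) eq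
        , indep-⊞ (indep-⊆ ⊟⊆ iB) far , ⊞⊆S′ (⊆S′ (B⊆S ∘ ⊟⊆) v∉⊟) w∈ w≢
      where
      u≢v : u ≢ v
      u≢v refl = u∉A v∈A
      w≢u : w ≢ u
      w≢u refl = proj₁ (far (∈⊟⁺ ∈⊞ u≢v)) refl
      u∉ : u ∉ swap A w
      u∉ p with ∈⊞⁻ p
      ... | inj₁ u≡w = w≢u (sym u≡w)
      ... | inj₂ q   = u∉A (⊟⊆ q)
      swap-⊞ : swap (A ⊞ u) w ≡ swap A w ⊞ u
      swap-⊞ = trans (cong (_⊞ w) (Vec.[]≔-commutes A u v u≢v)) (Vec.[]≔-commutes (A ⊟ v) u w (w≢u ∘ sym))

    -- T holds the other tokens and the one added next, if the next step is an
    -- addition; without this foresight the substitute w could block that step,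
    -- and with only k − 1 tokens on the graph it could not be moved away.
    Substitutes : Subset n → Set
    Substitutes A = ∃[ T ] (A ⊟ v ⊆ T × ∣ T ∣ ≤ k′ × T ⊆ S × Far v T × (∀ w → Good w T → Path S′ (swap A w) J))

    -- Both recurse on the remaining path: `avoid` copies it while `v` is free, `substitutes` covers
    -- a stretch during which `v` carries a token. The latter must serve every good `w`, since `w`
    -- is chosen by the step that precedes it.
    avoid : ∀ {A} → Path S A J → v ∉ A → Path S′ A J
    substitutes : ∀ {A} → Path S A J → v ∈ A → Substitutes A

    avoid ε v∉A = ε
    avoid {A} (_◅_ {j = B} s p) v∉A with v ∈? B
    avoid {A} (inj₁ (u , u∉ , B≡ , eq , iB , B⊆S) ◅ p) v∉A | no v∉B =
      inj₁ (u , u∉ , B≡ , eq , iB , ⊆S′ B⊆S v∉B) ◅ avoid p v∉B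
    avoid {A} (inj₂ (u , u∉ , A≡ , eq , iA , A⊆S) ◅ p) v∉A | no v∉B =
      inj₂ (u , u∉ , A≡ , eq , iA , ⊆S′ A⊆S v∉A) ◅ avoid p v∉B
    avoid {A} (inj₂ (u , u∉ , refl , eq , iA , A⊆S) ◅ p) v∉A | yes v∈B = contradiction (⊆⊞ v∈B) v∉A
    avoid {A} (inj₁ (u , u∉ , refl , eq , iB , B⊆S) ◅ p) v∉A | yes v∈B with ∈⊞⁻ v∈B
    ... | inj₂ v∈A  = contradiction v∈A v∉A
    ... | inj₁ refl =
      let T , B⊆T , T≤ , T⊆S , farT , go = substitutes p v∈B
          w , w∈ , w≢ , far = replace T T⊆S (≤-trans T≤ (n≤1+n k′)) farT
          A⊆T : A ⊆ T
          A⊆T = λ {x} x∈A → B⊆T (∈⊟⁺ (⊆⊞ x∈A) λ x≡v → v∉A (subst (_∈ A) x≡v x∈A))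
      in  inj₁ (add-good eq (indep-⊆ ⊆⊞ iB) (B⊆S ∘ ⊆⊞) v∉A (w∈ , w≢ , far-⊆ A⊆T far))
          ◅ subst (λ X → Path S′ (X ⊞ w) J) (⊞⊟ v∉A) (go w (w∈ , w≢ , far))

    substitutes ε v∈A = contradiction v∈A v∉J
    substitutes {A} (_◅_ {j = B} s p) v∈A with v ∈? B
    substitutes {A} (inj₁ (u , u∉ , refl , eq , iB , B⊆S) ◅ p) v∈A | no v∉B = contradiction (⊆⊞ v∈A) v∉B
    substitutes {A} (_◅_ {j = B} (inj₂ (u , u∉ , refl , eq , iA , A⊆S)) p) v∈A | no v∉B with ∈⊞⁻ v∈A
    ... | inj₂ v∈B  = contradiction v∈B v∉B
    -- The token leaves `v` here, and in the new path the substitute leaves `w`; nothing beyond the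
    -- present tokens has to be foreseen.
    ... | inj₁ refl = B , ⊆-reflexive (⊞⊟ u∉) , ≤-reflexive eq , A⊆S ∘ ⊆⊞
                    , (λ x∈B → (λ { refl → u∉ x∈B }) , iA ∈⊞ (⊆⊞ x∈B))
                    , λ w good → subst (λ X → Path S′ (X ⊞ w) J) (sym (⊞⊟ u∉))
                        (inj₂ (add-good eq (indep-⊆ ⊆⊞ iA) (A⊆S ∘ ⊆⊞) v∉B good) ◅ avoid p v∉B)
    -- The set `T` obtained for `B` contains `u`, so a substitute that suits `T` does not obstruct
    -- the addition of `u`.
    substitutes {A} (inj₁ (u , u∉ , refl , eq , iB , B⊆S) ◅ p) v∈A | yes v∈B =
      let T , B⊆T , T≤ , T⊆S , farT , go = substitutes p v∈B
      in  T , (λ x∈ → B⊆T (∈⊟⁺ (⊆⊞ (⊟⊆ x∈)) (proj₂ (∈⊟⁻ x∈)))) , T≤ , T⊆S , farT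
        , λ { w (w∈ , w≢ , far) → inj₁ (add-swapped v∈A u∉ eq iB B⊆S (w∈ , w≢ , far-⊆ B⊆T far)) ◅ go w (w∈ , w≢ , far) }
    substitutes {A} (_◅_ {j = B} (inj₂ (u , u∉ , refl , eq , iA , A⊆S)) p) v∈A | yes v∈B =
      let T , B⊆T , T≤ , T⊆S , farT , go = substitutes p v∈B
          ∣A-v∣ : ∣ A ⊟ v ∣ ≡ k′
          ∣A-v∣ = suc-injective (trans (∣⊟∣ v∈A) (trans (∣⊞∣ u∉) (cong suc eq)))
          T+u⊆S : T ⊞ u ⊆ S
          T+u⊆S = λ {x} p → case ∈⊞⁻ {A = T} {u} {x} p of λ { (inj₁ refl) → A⊆S ∈⊞ ; (inj₂ q) → T⊆S q }
          farT+u : Far v (T ⊞ u)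
          farT+u = λ {x} p → case ∈⊞⁻ {A = T} {u} {x} p of
            λ { (inj₁ refl) → (λ { refl → u∉ v∈B }) , iA v∈A ∈⊞ ; (inj₂ q) → farT q }
          w′ , w′∈ , w′≢ , far′ = replace (T ⊞ u) T+u⊆S (≤-trans (∣T⊞∣ T u) (s≤s T≤)) farT+u
          A-v⊆ : A ⊟ v ⊆ T ⊞ u
          A-v⊆ = λ {x} p → case ∈⊞⁻ {A = B} {u} {x} (⊟⊆ p) of
            λ { (inj₁ refl) → ∈⊞ ; (inj₂ q) → ⊆⊞ (B⊆T (∈⊟⁺ q (proj₂ (∈⊟⁻ {A = A} p)))) }
          good′ : Good w′ (A ⊟ v)
          good′ = w′∈ , w′≢ , far-⊆ A-v⊆ far′
          park : ∀ {w} → Good w (A ⊟ v) → Add S′ (A ⊟ v) (swap A w)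
          park = add-good ∣A-v∣ (indep-⊆ ⊟⊆ iA) (A⊆S ∘ ⊟⊆) v∉⊟
      -- All `k` tokens are present, so the one on `w` may be lifted and set down on `w′`, which
      -- also suits what follows, before `u` is removed.
      in  A ⊟ v , ⊆-refl , ≤-reflexive ∣A-v∣ , A⊆S ∘ ⊟⊆ , (λ x∈ → proj₂ (∈⊟⁻ x∈) , iA v∈A (⊟⊆ x∈))
        , λ w good → inj₂ (park good) ◅ inj₁ (park good′)
                   ◅ inj₂ (add-swapped v∈B u∉ eq iA A⊆S good′) ◅ go w′ (w′∈ , w′≢ , far-⊆ ⊆⊞ far′)
      where
      ∣T⊞∣ : ∀ (T : Subset n) u → ∣ T ⊞ u ∣ ≤ suc ∣ T ∣
      ∣T⊞∣ T u with u ∈? T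
      ... | no u∉T  = ≤-reflexive (∣⊞∣ u∉T)
      ... | yes u∈T = ≤-trans (p⊆q⇒∣p∣≤∣q∣ {p = T ⊞ u} {T} λ p → case ∈⊞⁻ p of λ { (inj₁ refl) → u∈T ; (inj₂ q) → q }) (n≤1+n _)

-- The greedy search

foldl-invariant : {A S : Set} {f : S → A → S} (P : S → Set) → (∀ s x → P s → P (f s x)) → ∀ xs {s} → P s → P (foldl f s xs)
foldl-invariant P h []       p = p
foldl-invariant P h (x ∷ xs) p = foldl-invariant P h xs (h _ x p)

-- Unlike in a plain invariant, `P` may refer to the entries already processed, so that at the end
-- it speaks about all of them.
foldl-history : {A S : Set} {f : S → A → S} (P : List A → S → Set) → (∀ done s x → P done s → P (x ∷ done) (f s x)) →
  ∀ xs {s} → P [] s → ∃[ done ] ((∀ {x} → x ∈ₗ xs → x ∈ₗ done) × P done (foldl f s xs))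
foldl-history {f = f} P h xs p = let done , _ , all , q = go xs p in done , all , q
  where
  go : ∀ xs {done s} → P done s → ∃[ done′ ] ((∀ {x} → x ∈ₗ done → x ∈ₗ done′) × (∀ {x} → x ∈ₗ xs → x ∈ₗ done′) × P done′ (foldl f s xs))
  go []       p = _ , id , (λ ()) , p
  go (x ∷ xs) p =
    let done , keep , all , q = go xs (h _ _ x p)
    in  done , keep ∘ there , (λ { (here refl) → keep (here refl) ; (there i) → all i }) , q

if-elim : ∀ {A Q : Set} (P : A → Set) (d : Dec Q) {a b : A} → (Q → P a) → (¬ Q → P b) → P (if does d then a else b)
if-elim P (yes q) f g = f q
if-elim P (no ¬q) f g = g ¬q

singleton-meets : ∀ {n} {S : Subset n} {x} → x ∈ S → Nonempty (⁅ x ⁆ ∩ S)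
singleton-meets {x = x} x∈S = x , x∈p∩q⁺ (x∈⁅x⁆ x , x∈S)

meets-singleton : ∀ {n} {S : Subset n} {x} → Nonempty (⁅ x ⁆ ∩ S) → x ∈ S
meets-singleton {S = S} {x} (y , y∈) with x∈p∩q⁻ ⁅ x ⁆ S y∈
... | y∈x , y∈S rewrite x∈⁅y⁆⇒x≡y x y∈x = y∈S

x∉p─q : ∀ {n} (p q : Subset n) {x} → x ∈ p ─ q → x ∉ q
x∉p─q (_ ∷ p) (true  ∷ q) (Data.Vec.there i) (Data.Vec.there j) = x∉p─q p q i j
x∉p─q (_ ∷ p) (false ∷ q) (Data.Vec.there i) (Data.Vec.there j) = x∉p─q p q i j

∣p∪q∣≤∣p∣+∣q∣ : ∀ {n} (p q : Subset n) → ∣ p ∪ q ∣ ≤ ∣ p ∣ + ∣ q ∣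
∣p∪q∣≤∣p∣+∣q∣ []          []          = z≤n
∣p∪q∣≤∣p∣+∣q∣ (true  ∷ p) (true  ∷ q) = s≤s (≤-trans (∣p∪q∣≤∣p∣+∣q∣ p q) (+-monoʳ-≤ ∣ p ∣ (n≤1+n _)))
∣p∪q∣≤∣p∣+∣q∣ (true  ∷ p) (false ∷ q) = s≤s (∣p∪q∣≤∣p∣+∣q∣ p q)
∣p∪q∣≤∣p∣+∣q∣ (false ∷ p) (true  ∷ q) = ≤-trans (s≤s (∣p∪q∣≤∣p∣+∣q∣ p q)) (≤-reflexive (sym (+-suc ∣ p ∣ ∣ q ∣)))
∣p∪q∣≤∣p∣+∣q∣ (false ∷ p) (false ∷ q) = ∣p∪q∣≤∣p∣+∣q∣ p q

elements : ∀ {n} → Subset n → List (Fin n)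
elements []          = []
elements (true  ∷ A) = zero ∷ map suc (elements A)
elements (false ∷ A) = map suc (elements A)

length-elements : ∀ {n} (A : Subset n) → length (elements A) ≡ ∣ A ∣
length-elements []          = refl
length-elements (true  ∷ A) = cong suc (trans (length-map suc (elements A)) (length-elements A))
length-elements (false ∷ A) = trans (length-map suc (elements A)) (length-elements A)

∈-elements⁺ : ∀ {n} {A : Subset n} {x} → x ∈ A → x ∈ₗ elements A
∈-elements⁺ Data.Vec.here                  = here refl
∈-elements⁺ (Data.Vec.there {y = true}  p) = there (∈-map⁺ suc (∈-elements⁺ p))
∈-elements⁺ (Data.Vec.there {y = false} p) = ∈-map⁺ suc (∈-elements⁺ p)

∈-elements⁻ : ∀ {n} {A : Subset n} {x} → x ∈ₗ elements A → x ∈ A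
∈-elements⁻ {A = true  ∷ A} (here refl) = Data.Vec.here
∈-elements⁻ {A = true  ∷ A} (there p) with ∈-map⁻ suc p
... | _ , q , refl = Data.Vec.there (∈-elements⁻ q)
∈-elements⁻ {A = false ∷ A} p with ∈-map⁻ suc p
... | _ , q , refl = Data.Vec.there (∈-elements⁻ q)

∣⊟∣-≤ : ∀ {n} (X : Subset n) a → ∣ X ∣ ≤ suc ∣ X ⊟ a ∣
∣⊟∣-≤ X a with a ∈? X
... | yes a∈X = ≤-reflexive (trans (cong ∣_∣ (sym (⊟⊞ a∈X))) (∣⊞∣ λ p → proj₂ (∈⊟⁻ {A = X} p) refl))
... | no  a∉X = ≤-trans (p⊆q⇒∣p∣≤∣q∣ {p = X} {X ⊟ a} λ p → ∈⊟⁺ p λ { refl → a∉X p }) (n≤1+n _)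

covered-≤ : ∀ {n} (l : List (Fin n)) (X : Subset n) → (∀ {x} → x ∈ X → x ∈ₗ l) → ∣ X ∣ ≤ length l
covered-≤ {n} []      X c = ≤-trans (p⊆q⇒∣p∣≤∣q∣ {p = X} {∅} (λ p → case c p of λ ())) (≤-reflexive (∣⊥∣≡0 n))
covered-≤ (a ∷ l) X c = ≤-trans (∣⊟∣-≤ X a) (s≤s (covered-≤ l (X ⊟ a) λ p →
  let x∈X , x≢a = ∈⊟⁻ {A = X} p
  in  case c x∈X of λ { (here x≡a) → contradiction x≡a x≢a ; (there q) → q }))

module Greedy {n : ℕ} (N : Fin n → Subset n) where
  open Algorithm N

  closed⁺ : ∀ {x y} → y ≡ x ⊎ y ∈ N x → y ∈ closed x
  closed⁺ {x} (inj₁ refl) = x∈p∪q⁺ (inj₁ (x∈⁅x⁆ x))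
  closed⁺     (inj₂ y∈N)  = x∈p∪q⁺ (inj₂ y∈N)

  closed⁻ : ∀ {x y} → y ∈ closed x → y ≡ x ⊎ y ∈ N x
  closed⁻ {x} y∈ with x∈p∪q⁻ ⁅ x ⁆ (N x) y∈
  ... | inj₁ p = inj₁ (x∈⁅y⁆⇒x≡y x p)
  ... | inj₂ p = inj₂ p

  ∣closed∩∣ : ∀ S x → ∣ closed x ∩ S ∣ ≤ suc ∣ N x ∩ S ∣
  ∣closed∩∣ S x = begin
    ∣ closed x ∩ S ∣                    ≡⟨ cong ∣_∣ (∩-distribʳ-∪ S ⁅ x ⁆ (N x)) ⟩
    ∣ (⁅ x ⁆ ∩ S) ∪ (N x ∩ S) ∣         ≤⟨ ∣p∪q∣≤∣p∣+∣q∣ (⁅ x ⁆ ∩ S) (N x ∩ S) ⟩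
    ∣ ⁅ x ⁆ ∩ S ∣ + ∣ N x ∩ S ∣         ≤⟨ +-monoˡ-≤ _ (≤-trans (∣p∩q∣≤∣p∣ ⁅ x ⁆ S) (≤-reflexive (∣⁅x⁆∣≡1 x))) ⟩
    suc ∣ N x ∩ S ∣                     ∎
    where open ≤-Reasoning

  module _ (irreflexive : ∀ {u} → u ∉ N u) (symmetric : ∀ {u v} → v ∈ N u → u ∈ N v) where
    open Tokens N irreflexive symmetric

    -- A pigeonhole count that keeps no record of the petals. Either some chosen `closed x` misses
    -- `T`, and `x` is the vertex sought, or it brings an element of `T` into `H`. This element is
    -- new because `closed x` avoids `H`, and it is not discarded because `T` lies outside
    -- `closed u`. Using up `P` would thus need more than `suc k′` elements in `T`.
    redundant⇒replaceable : ∀ k′ D P S u → suc k′ < length P → redundant D P S u ≡ true → Replaceable k′ S u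
    redundant⇒replaceable k′ D P S u k<P red T T⊆S ∣T∣≤k farT =
      conclude (foldl-invariant Invariant preserve (allFin n) (inj₂ (m≤m+n _ _))) red
      where
      Found : Set
      Found = ∃[ x ] (x ∈ S × x ≢ u × Far k′ x T)

      Invariant : Subset n × List Bool → Set
      Invariant (H , rest) = Found ⊎ length P ≤ length rest + ∣ T ∩ H ∣

      tail-≤ : ∀ (l : List Bool) {a b} → a < b → length l + a ≤ length (tail′ l) + b
      tail-≤ []      {a} {b} a<b = <⇒≤ a<b
      tail-≤ (_ ∷ l) {a} {b} a<b = ≤-trans (≤-reflexive (sym (+-suc (length l) a))) (+-monoʳ-≤ (length l) a<b)

      enlarge : ∀ H rest x → length P ≤ length rest + ∣ T ∩ H ∣ → Candidate D S u H x →
        Invariant (H ∪ ((closed x ∩ S) ─ closed u) , tail′ rest)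
      enlarge H rest x P≤ (x∈S , x≢u , _ , apart) with nonempty? (closed x ∩ T)
      ... | no empty = inj₁ (x , meets-singleton x∈S , (λ { refl → x≢u (singleton-meets (x∈⁅x⁆ x)) })
                , λ {y} y∈T → (λ { refl → empty (y , x∈p∩q⁺ (closed⁺ (inj₁ refl) , y∈T)) })
                          , λ y∈N → empty (y , x∈p∩q⁺ (closed⁺ (inj₂ y∈N) , y∈T)))
      ... | yes (y , y∈) = inj₂ (≤-trans P≤ (tail-≤ rest (p⊂q⇒∣p∣<∣q∣ (grows , y , x∈p∩q⁺ (y∈T , y∈H′) , y∉))))
        where
        y∈closed = proj₁ (x∈p∩q⁻ (closed x) T y∈)
        y∈T = proj₂ (x∈p∩q⁻ (closed x) T y∈)
        H′ = H ∪ ((closed x ∩ S) ─ closed u)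
        y∉u : y ∉ closed u
        y∉u p with closed⁻ p
        ... | inj₁ y≡u = proj₁ (farT y∈T) y≡u
        ... | inj₂ y∈N = proj₂ (farT y∈T) y∈N
        y∈H′ : y ∈ H′
        y∈H′ = x∈p∪q⁺ (inj₂ (x∈p∧x∉q⇒x∈p─q (x∈p∩q⁺ (y∈closed , T⊆S y∈T)) y∉u))
        y∉ : y ∉ T ∩ H
        y∉ p = apart (y , x∈p∩q⁺ (y∈closed , proj₂ (x∈p∩q⁻ T H p)))
        grows : T ∩ H ⊆ T ∩ H′
        grows p = let a , b = x∈p∩q⁻ T H p in x∈p∩q⁺ (a , x∈p∪q⁺ (inj₁ b))

      preserve : ∀ s x → Invariant s → Invariant (collect D S u s x)
      preserve s x (inj₁ found) = inj₁ found
      preserve (H , rest) x (inj₂ P≤) = if-elim Invariant (candidate? D S u H x) (enlarge H rest x P≤) (λ _ → inj₂ P≤)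

      conclude : ∀ {s} → Invariant s → not (nonempty (proj₂ s)) ≡ true → Found
      conclude (inj₁ found) _ = found
      conclude {H , []} (inj₂ P≤) _ = contradiction (≤-trans P≤ (≤-trans (∣p∩q∣≤∣p∣ T H) ∣T∣≤k)) (<⇒≱ k<P)

  -- What a failed search leaves behind. Chosen vertices are listed apart from the hitting set,
  -- because the closed neighbourhood of a chosen vertex within `S` may lie wholly inside `closed u`
  -- and contribute nothing to it.
  record Obstruction (D p : ℕ) (S : Subset n) (u : Fin n) : Set where
    field
      chosen hitting : List (Fin n)
      chosen-≤  : length chosen ≤ p
      hitting-≤ : length hitting ≤ p * D
      hitting⊆  : ∀ {y} → y ∈ₗ hitting → y ∈ S × y ∉ closed u
      hits      : ∀ {x} → x ∈ S → x ≢ u → ∣ N x ∩ S ∣ < D → x ∈ₗ chosen ⊎ (∃[ y ] (y ∈ₗ hitting × y ∈ closed x))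

  irredundant⇒obstruction : ∀ D p P S u → length P ≡ suc p → redundant D P S u ≡ false → Obstruction D p S u
  irredundant⇒obstruction D p P S u ∣P∣ irr =
    let done , all , inv = foldl-history Invariant preserve (allFin n) {∅ , P}
          (inj₂ ([] , refl , ≤-reflexive (∣⊥∣≡0 n) , (λ y∈ → contradiction y∈ ∉⊥) , λ ()))
    in  conclude done (λ x → all (∈-allFin x)) inv irr
    where
    Invariant : List (Fin n) → Subset n × List Bool → Set
    -- An empty `rest` means that the search succeeded; it persists through later steps and is
    -- refuted at the end by `irr`.
    Invariant done (H , rest) = rest ≡ [] ⊎ (∃[ chosen ] (length chosen + length rest ≡ length P × ∣ H ∣ ≤ length chosen * D
      × (∀ {y} → y ∈ H → y ∈ S × y ∉ closed u)
      × (∀ {x} → x ∈ₗ done → x ∈ S → x ≢ u → ∣ N x ∩ S ∣ < D → x ∈ₗ chosen ⊎ (∃[ y ] (y ∈ H × y ∈ closed x)))))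

    skip : ∀ done H rest x → Invariant done (H , rest) → ¬ Candidate D S u H x → Invariant (x ∷ done) (H , rest)
    skip done H rest x (inj₁ eq) _ = inj₁ eq
    skip done H rest x (inj₂ (ch , eq , ∣H∣ , H⊆ , hits)) not-cand = inj₂ (ch , eq , ∣H∣ , H⊆ , hits′)
      where
      hits′ : ∀ {z} → z ∈ₗ x ∷ done → z ∈ S → z ≢ u → ∣ N z ∩ S ∣ < D → z ∈ₗ ch ⊎ (∃[ y ] (y ∈ H × y ∈ closed z))
      hits′ (there i)   = hits i
      hits′ (here refl) x∈S x≢u low with nonempty? (closed x ∩ H)
      ... | yes (y , y∈) = let a , b = x∈p∩q⁻ (closed x) H y∈ in inj₂ (y , b , a)
      ... | no  empty    = contradiction (singleton-meets x∈S , (λ m → x≢u (x∈⁅y⁆⇒x≡y u (meets-singleton m))) , low , empty) not-cand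

    enlarge : ∀ done H rest x → Invariant done (H , rest) → Candidate D S u H x →
      Invariant (x ∷ done) (H ∪ ((closed x ∩ S) ─ closed u) , tail′ rest)
    enlarge done H .[] x (inj₁ refl) _ = inj₁ refl
    enlarge done H [] x (inj₂ _) _ = inj₁ refl
    enlarge done H (b ∷ rest) x (inj₂ (ch , eq , ∣H∣ , H⊆ , hits)) (x∈S , x≢u , low , apart) =
      inj₂ (x ∷ ch , trans (sym (+-suc _ _)) eq , ∣H′∣≤ , H′⊆ , hits′)
      where
      A = (closed x ∩ S) ─ closed u
      H′ = H ∪ A
      ∣H′∣≤ : ∣ H′ ∣ ≤ D + length ch * D
      ∣H′∣≤ = begin
        ∣ H′ ∣                 ≤⟨ ∣p∪q∣≤∣p∣+∣q∣ H A ⟩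
        ∣ H ∣ + ∣ A ∣          ≡⟨ +-comm ∣ H ∣ ∣ A ∣ ⟩
        ∣ A ∣ + ∣ H ∣          ≤⟨ +-mono-≤ (≤-trans (∣p─q∣≤∣p∣ (closed x ∩ S) (closed u)) (≤-trans (∣closed∩∣ S x) low)) ∣H∣ ⟩
        D + length ch * D      ∎
        where open ≤-Reasoning
      H′⊆ : ∀ {y} → y ∈ H′ → y ∈ S × y ∉ closed u
      H′⊆ {y} y∈ with x∈p∪q⁻ H A y∈
      ... | inj₁ p = H⊆ p
      ... | inj₂ p = proj₂ (x∈p∩q⁻ (closed x) S (p─q⊆p (closed x ∩ S) (closed u) p)) , x∉p─q (closed x ∩ S) (closed u) p
      hits′ : ∀ {z} → z ∈ₗ x ∷ done → z ∈ S → z ≢ u → ∣ N z ∩ S ∣ < D → z ∈ₗ x ∷ ch ⊎ (∃[ y ] (y ∈ H′ × y ∈ closed z))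
      hits′ (here refl) _ _ _ = inj₁ (here refl)
      hits′ (there i) a b c with hits i a b c
      ... | inj₁ p           = inj₁ (there p)
      ... | inj₂ (y , p , q) = inj₂ (y , x∈p∪q⁺ (inj₁ p) , q)

    preserve : ∀ done s x → Invariant done s → Invariant (x ∷ done) (collect D S u s x)
    preserve done (H , rest) x inv =
      if-elim (Invariant (x ∷ done)) (candidate? D S u H x) (enlarge done H rest x inv) (skip done H rest x inv)

    conclude : ∀ {s} done → (∀ x → x ∈ₗ done) → Invariant done s → not (nonempty (proj₂ s)) ≡ false → Obstruction D p S u
    conclude {H , _ ∷ rest} done all (inj₂ (ch , eq , ∣H∣ , H⊆ , hits)) _ = record
      { chosen    = ch
      ; hitting   = elements H
      ; chosen-≤  = ch≤
      ; hitting-≤ = ≤-trans (≤-reflexive (length-elements H)) (≤-trans ∣H∣ (*-monoˡ-≤ D ch≤))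
      ; hitting⊆  = λ y∈ → H⊆ (∈-elements⁻ y∈)
      ; hits      = λ {x} a b c → case hits (all x) a b c of λ
          { (inj₁ p) → inj₁ p ; (inj₂ (y , p , q)) → inj₂ (y , ∈-elements⁺ p , q) }
      }
      where
      ch≤ : length ch ≤ p
      ch≤ = suc-injective-≤ (≤-trans (m≤m+n (suc (length ch)) (length rest)) (≤-reflexive (trans (sym (+-suc _ _)) (trans eq ∣P∣))))
        where
        suc-injective-≤ : ∀ {a b} → suc a ≤ suc b → a ≤ b
        suc-injective-≤ (s≤s q) = q

-- The size of the kernel

sumOver : ∀ {n} → Subset n → (Fin n → ℕ) → ℕ
sumOver []          f = 0
sumOver (true  ∷ A) f = f zero + sumOver A (f ∘ suc)
sumOver (false ∷ A) f = sumOver A (f ∘ suc)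

indicator : Bool → ℕ
indicator b = if b then 1 else 0

sumOver-mono : ∀ {n} (A : Subset n) {f g} → (∀ {x} → x ∈ A → f x ≤ g x) → sumOver A f ≤ sumOver A g
sumOver-mono []          h = z≤n
sumOver-mono (true  ∷ A) h = +-mono-≤ (h Data.Vec.here) (sumOver-mono A (h ∘ Data.Vec.there))
sumOver-mono (false ∷ A) h = sumOver-mono A (h ∘ Data.Vec.there)

sumOver-+ : ∀ {n} (A : Subset n) f g → sumOver A (λ x → f x + g x) ≡ sumOver A f + sumOver A g
sumOver-+ []          f g = refl
sumOver-+ (true  ∷ A) f g =
  trans (cong (f zero + g zero +_) (sumOver-+ A _ _)) (interchange +-commutativeSemigroup (f zero) (g zero) _ _)
sumOver-+ (false ∷ A) f g = sumOver-+ A _ _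

sumOver-remove : ∀ {n} {A : Subset n} {v} f → v ∈ A → sumOver A f ≡ f v + sumOver (A ⊟ v) f
sumOver-remove f Data.Vec.here = refl
sumOver-remove {A = true ∷ A} {suc v} f (Data.Vec.there p) = begin
  f zero + sumOver A (f ∘ suc)                          ≡⟨ cong (f zero +_) (sumOver-remove (f ∘ suc) p) ⟩
  f zero + (f (suc v) + sumOver (A ⊟ v) (f ∘ suc))      ≡⟨ sym (+-assoc (f zero) _ _) ⟩
  f zero + f (suc v) + sumOver (A ⊟ v) (f ∘ suc)        ≡⟨ cong (_+ sumOver (A ⊟ v) (f ∘ suc)) (+-comm (f zero) _) ⟩
  f (suc v) + f zero + sumOver (A ⊟ v) (f ∘ suc)        ≡⟨ +-assoc (f (suc v)) _ _ ⟩
  f (suc v) + (f zero + sumOver (A ⊟ v) (f ∘ suc))      ∎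
  where open ≡-Reasoning
sumOver-remove {A = false ∷ A} f (Data.Vec.there p) = sumOver-remove (f ∘ suc) p

sumOver-const : ∀ {n} (A : Subset n) c → sumOver A (λ _ → c) ≡ ∣ A ∣ * c
sumOver-const []          c = refl
sumOver-const (true  ∷ A) c = cong (c +_) (sumOver-const A c)
sumOver-const (false ∷ A) c = sumOver-const A c

sumOver-indicator : ∀ {n} (A B : Subset n) c → sumOver A (λ x → indicator (lookup B x) * c) ≡ ∣ A ∩ B ∣ * c
sumOver-indicator []          []          c = refl
sumOver-indicator (true  ∷ A) (true  ∷ B) c = cong₂ _+_ (*-identityˡ c) (sumOver-indicator A B c)
sumOver-indicator (true  ∷ A) (false ∷ B) c = sumOver-indicator A B c
sumOver-indicator (false ∷ A) (b     ∷ B) c = sumOver-indicator A B c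

module _ {n : ℕ} {P : Fin n → Set} (P? : ∀ x → Dec (P x)) where

  comprehension : Subset n
  comprehension = tabulate (λ x → does (P? x))

  comprehension⁺ : ∀ {x} → P x → lookup comprehension x ≡ true
  comprehension⁺ {x} p = trans (Vec.lookup∘tabulate _ x) (dec-true (P? x) p)

  comprehension⁻ : ∀ {x} → x ∈ comprehension → P x
  comprehension⁻ {x} q with P? x | trans (sym (Vec.lookup∘tabulate (λ x → does (P? x)) x)) (Vec.[]=⇒lookup q)
  ... | yes p | _ = p

module Kernel {n : ℕ} (N : Fin n → Subset n) (symmetric : ∀ {u v} → v ∈ N u → u ∈ N v) where
  open Algorithm N
  open Greedy N

  -- Deleting a vertex of degree at most `d` takes its own term, at most `d`, from the sum and
  -- lowers the terms of its neighbours by one each, again at most `d` in total.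
  degree-sum : ∀ d → (∀ S → Nonempty S → ∃[ v ] (v ∈ S × ∣ N v ∩ S ∣ ≤ d)) →
    ∀ m S → ∣ S ∣ ≤ m → sumOver S (λ x → ∣ N x ∩ S ∣) ≤ ∣ S ∣ * (d + d)
  degree-sum d degenerate m S ∣S∣≤m with nonempty? S
  degree-sum d degenerate m S ∣S∣≤m | no empty rewrite Empty-unique empty =
    ≤-trans (sumOver-mono (∅ {n}) {g = λ _ → 0} (λ p → contradiction p ∉⊥)) (≤-trans (≤-reflexive (sumOver-const (∅ {n}) 0)) (≤-trans (≤-reflexive (*-zeroʳ ∣ ∅ {n} ∣)) z≤n))
  degree-sum d degenerate m S ∣S∣≤m | yes ne with degenerate S ne
  degree-sum d degenerate zero S ∣S∣≤m | yes ne | v , v∈S , ∣v∣≤d =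
    contradiction (≤-trans (x∈p⇒∣p-x∣<∣p∣ v∈S) ∣S∣≤m) λ ()
  degree-sum d degenerate (suc m) S ∣S∣≤m | yes ne | v , v∈S , ∣v∣≤d = begin
    sumOver S (λ x → ∣ N x ∩ S ∣)
      ≡⟨ sumOver-remove _ v∈S ⟩
    ∣ N v ∩ S ∣ + sumOver S′ (λ x → ∣ N x ∩ S ∣)
      ≤⟨ +-mono-≤ ∣v∣≤d (sumOver-mono S′ λ {x} _ → split x) ⟩
    d + sumOver S′ (λ x → ∣ N x ∩ S′ ∣ + indicator (lookup (N v) x) * 1)
      ≡⟨ cong (d +_) (trans (sumOver-+ S′ (λ x → ∣ N x ∩ S′ ∣) _) (cong (sumOver S′ (λ x → ∣ N x ∩ S′ ∣) +_) (trans (sumOver-indicator S′ (N v) 1) (*-identityʳ _)))) ⟩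
    d + (sumOver S′ (λ x → ∣ N x ∩ S′ ∣) + ∣ S′ ∩ N v ∣)
      ≤⟨ +-monoʳ-≤ d (+-mono-≤ (degree-sum d degenerate m S′ (s≤s⁻¹ (≤-trans (≤-reflexive ∣S∣≡) ∣S∣≤m))) meets≤) ⟩
    d + (∣ S′ ∣ * (d + d) + d)
      ≡⟨ cong (d +_) (+-comm (∣ S′ ∣ * (d + d)) d) ⟩
    d + (d + ∣ S′ ∣ * (d + d))
      ≡⟨ sym (+-assoc d d _) ⟩
    suc ∣ S′ ∣ * (d + d)
      ≡⟨ cong (_* (d + d)) ∣S∣≡ ⟩
    ∣ S ∣ * (d + d) ∎
    where
    open ≤-Reasoning
    S′ = S ⊟ v
    S′⊆S : S′ ⊆ S
    S′⊆S p = proj₁ (∈⊟⁻ {A = S} p)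
    ∣S∣≡ : suc ∣ S′ ∣ ≡ ∣ S ∣
    ∣S∣≡ = trans (sym (∣⊞∣ λ p → proj₂ (∈⊟⁻ {A = S} p) refl)) (cong ∣_∣ (⊟⊞ v∈S))
    meets≤ : ∣ S′ ∩ N v ∣ ≤ d
    meets≤ = ≤-trans (p⊆q⇒∣p∣≤∣q∣ {p = S′ ∩ N v} {N v ∩ S} λ p → let a , b = x∈p∩q⁻ S′ (N v) p in x∈p∩q⁺ (b , S′⊆S a)) ∣v∣≤d
    split : ∀ x → ∣ N x ∩ S ∣ ≤ ∣ N x ∩ S′ ∣ + indicator (lookup (N v) x) * 1
    split x with v ∈? N x
    ... | no v∉ = ≤-trans (p⊆q⇒∣p∣≤∣q∣ {p = N x ∩ S} {N x ∩ S′} λ p → let a , b = x∈p∩q⁻ (N x) S p in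
                    x∈p∩q⁺ (a , ∈⊟⁺ b λ { refl → v∉ a })) (m≤m+n _ _)
    ... | yes v∈ rewrite Vec.[]=⇒lookup (symmetric v∈) =
      ≤-trans (∣⊟∣-≤ (N x ∩ S) v) (≤-trans (s≤s (p⊆q⇒∣p∣≤∣q∣ {p = (N x ∩ S) ⊟ v} {N x ∩ S′} λ p →
        let a , b = ∈⊟⁻ {A = N x ∩ S} p
            e , f = x∈p∩q⁻ (N x) S a
        in  x∈p∩q⁺ (e , ∈⊟⁺ f b))) (≤-reflexive (+-comm 1 _)))

  -- For each `x` in `S`, its degree is at least `D`, or it is low and is credited with `D`. Summing
  -- over `S` gives `D |S| ≤ 2d |S| + D · length l`; as `D > 2d`, at least one `|S|` survives the
  -- cancellation.
  size≤low : ∀ d D S (l : List (Fin n)) → (∀ S → Nonempty S → ∃[ v ] (v ∈ S × ∣ N v ∩ S ∣ ≤ d)) → suc (d + d) ≤ D →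
    (∀ {x} → x ∈ S → ∣ N x ∩ S ∣ < D → x ∈ₗ l) → ∣ S ∣ ≤ length l * D
  size≤low d D S l degenerate 2d<D covers = +-cancelʳ-≤ (∣ S ∣ * (d + d)) ∣ S ∣ (length l * D) (begin
    ∣ S ∣ + ∣ S ∣ * (d + d)        ≡⟨ sym (*-suc ∣ S ∣ (d + d)) ⟩
    ∣ S ∣ * suc (d + d)            ≤⟨ *-monoʳ-≤ ∣ S ∣ 2d<D ⟩
    ∣ S ∣ * D                      ≡⟨ sym (sumOver-const S D) ⟩
    sumOver S (λ _ → D)            ≤⟨ sumOver-mono S (λ {x} _ → split x) ⟩
    sumOver S (λ x → ∣ N x ∩ S ∣ + indicator (lookup L x) * D)
                                   ≡⟨ trans (sumOver-+ S (λ x → ∣ N x ∩ S ∣) _) (cong (sumOver S (λ x → ∣ N x ∩ S ∣) +_) (sumOver-indicator S L D)) ⟩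
    sumOver S (λ x → ∣ N x ∩ S ∣) + ∣ S ∩ L ∣ * D
                                   ≤⟨ +-mono-≤ (degree-sum d degenerate ∣ S ∣ S ≤-refl) (*-monoˡ-≤ D (covered-≤ l (S ∩ L) low)) ⟩
    ∣ S ∣ * (d + d) + length l * D ≡⟨ +-comm (∣ S ∣ * (d + d)) _ ⟩
    length l * D + ∣ S ∣ * (d + d) ∎)
    where
    open ≤-Reasoning
    low? : ∀ x → Dec (∣ N x ∩ S ∣ < D)
    low? x = ∣ N x ∩ S ∣ <? D
    L = comprehension low?
    split : ∀ x → D ≤ ∣ N x ∩ S ∣ + indicator (lookup L x) * D
    split x with low? x
    ... | yes h rewrite comprehension⁺ low? h = ≤-trans (≤-reflexive (sym (*-identityˡ D))) (m≤n+m (1 * D) ∣ N x ∩ S ∣)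
    ... | no  h = ≤-trans (≮⇒≥ h) (m≤m+n _ _)
    low : ∀ {x} → x ∈ S ∩ L → x ∈ₗ l
    low p = let x∈S , x∈L = x∈p∩q⁻ S L p in covers x∈S (comprehension⁻ low? x∈L)

  concat-cover : ∀ {B : Fin n → Fin n → Set} b (ys : List (Fin n)) →
    (∀ {y} → y ∈ₗ ys → ∃[ l ] (length l ≤ b × (∀ {x} → B y x → x ∈ₗ l))) →
    ∃[ l ] (length l ≤ length ys * b × (∀ {x y} → y ∈ₗ ys → B y x → x ∈ₗ l))
  concat-cover b []       h = [] , z≤n , λ ()
  concat-cover b (y ∷ ys) h =
    let l , l≤ , c = h (here refl)
        m , m≤ , e = concat-cover b ys (h ∘ there)
    in  l ++ m , ≤-trans (≤-reflexive (length-++ l)) (+-mono-≤ l≤ m≤)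
      , λ { (here refl) q → ∈-++⁺ˡ (c q) ; (there i) q → ∈-++⁺ʳ l (e i q) }

  -- The hitting set of one such vertex u avoids N[u] ⊇ C, so that its elements y
  -- properly extend C.
  low-cover : ∀ p D (S I : Subset n) → D ≡ suc (p + p) → (∀ {u} → u ∈ S → u ∉ I → Obstruction D p S u) →
    ∀ r C → D < ∣ C ∣ + r → ∃[ l ] (length l ≤ (D * D) ^ r ×
      (∀ {x} → x ∈ S → x ∉ I → ∣ N x ∩ S ∣ < D → C ⊆ closed x ∩ S → x ∈ₗ l))
  low-cover p D S I D≡ obstruct zero C D< = [] , z≤n , λ {x} _ _ low C⊆ →
    contradiction (≤-trans D< (≤-trans (≤-reflexive (+-identityʳ ∣ C ∣)) (≤-trans (p⊆q⇒∣p∣≤∣q∣ C⊆) (≤-trans (∣closed∩∣ S x) low)))) (<-irrefl refl)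
  low-cover p D S I D≡ obstruct (suc r) C D<
    with Fin.any? (λ u → (u ∈? S) ×-dec ¬? (u ∈? I) ×-dec (∣ N u ∩ S ∣ <? D) ×-dec (C ⊆? closed u ∩ S))
  ... | no none = [] , z≤n , λ {x} a b c e → contradiction (x , a , b , c , λ {_} → e) none
  ... | yes (u , u∈S , u∉I , u-low , C⊆u) =
    u ∷ chosen ++ rest , bound , covers
    where
    open Obstruction (obstruct u∈S u∉I)
    M = (D * D) ^ r
    Extends : Fin n → Fin n → Set
    Extends y x = x ∈ S × x ∉ I × ∣ N x ∩ S ∣ < D × C ⊞ y ⊆ closed x ∩ S
    -- In place of selecting a most frequent `y`, all elements of the hitting set are branched on,
    -- and their covers are concatenated.
    each : ∀ {y} → y ∈ₗ hitting → ∃[ l ] (length l ≤ M × (∀ {x} → Extends y x → x ∈ₗ l))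
    each {y} y∈ =
      let y∈S , y∉u = hitting⊆ y∈
          y∉C : y ∉ C
          y∉C = λ y∈C → y∉u (proj₁ (x∈p∩q⁻ (closed u) S (C⊆u y∈C)))
          l , l≤ , c = low-cover p D S I D≡ obstruct r (C ⊞ y)
            (≤-trans D< (≤-reflexive (trans (+-suc ∣ C ∣ r) (cong (_+ r) (sym (∣⊞∣ y∉C))))))
      in  l , l≤ , λ (a , b , e , f) → c a b e f
    cover = concat-cover {Extends} M hitting each
    rest = proj₁ cover
    bound : suc (length (chosen ++ rest)) ≤ D * D * M
    bound = begin
      suc (length (chosen ++ rest))            ≡⟨ cong suc (length-++ chosen) ⟩
      suc (length chosen) + length rest        ≤⟨ +-mono-≤ (s≤s chosen-≤) (≤-trans (proj₁ (proj₂ cover)) (*-monoˡ-≤ M hitting-≤)) ⟩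
      suc p + p * D * M                        ≤⟨ +-monoˡ-≤ (p * D * M) (≤-trans (≤-reflexive (sym (*-identityʳ (suc p)))) (*-monoʳ-≤ (suc p) 1≤M)) ⟩
      suc p * M + p * D * M                    ≡⟨ sym (*-distribʳ-+ M (suc p) (p * D)) ⟩
      (suc p + p * D) * M                      ≤⟨ *-monoˡ-≤ M square ⟩
      D * D * M                                ∎
      where
      open ≤-Reasoning
      1≤D : 1 ≤ D
      1≤D = ≤-trans (s≤s z≤n) (≤-reflexive (sym D≡))
      1≤M : 1 ≤ M
      1≤M = ≤-trans (≤-reflexive (sym (^-zeroˡ r))) (^-monoˡ-≤ r (*-mono-≤ 1≤D 1≤D))
      -- One for `u`, at most `p` for the chosen vertices and `p D` for the branches: together at
      -- most `suc p * D`, as `suc p ≤ D`.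
      square : suc p + p * D ≤ D * D
      square = begin
        suc p + p * D            ≤⟨ +-monoˡ-≤ (p * D) (≤-trans (s≤s (m≤m+n p p)) (≤-reflexive (sym D≡))) ⟩
        D + p * D                ≤⟨ *-monoˡ-≤ D (≤-trans (s≤s (m≤m+n p p)) (≤-reflexive (sym D≡))) ⟩
        D * D                    ∎
    covers : ∀ {x} → x ∈ S → x ∉ I → ∣ N x ∩ S ∣ < D → C ⊆ closed x ∩ S → x ∈ₗ u ∷ chosen ++ rest
    covers {x} a b c C⊆x with x Fin.≟ u
    ... | yes refl = here refl
    ... | no  x≢u with hits a x≢u c
    ...   | inj₁ i = there (∈-++⁺ˡ i)
    ...   | inj₂ (y , y∈ , y∈x) = there (∈-++⁺ʳ chosen (proj₂ (proj₂ cover) y∈ (a , b , c , C+y⊆)))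
      where
      C+y⊆ : C ⊞ y ⊆ closed x ∩ S
      C+y⊆ q with ∈⊞⁻ {A = C} q
      ... | inj₁ refl = x∈p∩q⁺ (y∈x , proj₁ (hitting⊆ y∈))
      ... | inj₂ q    = C⊆x q

  -- From `C = ∅` the recursion is given depth `suc D`, so at most `M = (D * D) ^ suc D` low
  -- vertices lie outside `I ∪ J`, and at most `2p` inside. Then `2p + M ≤ (2p + 1) M = D M`, and
  -- the factor `D` from `size≤low` yields `D * D * M = D ^ (2D + 4)`.
  kernel-size : ∀ d p D (S I J : Subset n) → D ≡ suc (p + p) → d ≤ p → ∣ I ∣ ≤ p → ∣ J ∣ ≤ p →
    (∀ S → Nonempty S → ∃[ v ] (v ∈ S × ∣ N v ∩ S ∣ ≤ d)) → (∀ {u} → u ∈ S → u ∉ I ∪ J → Obstruction D p S u) →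
    ∣ S ∣ ≤ D ^ (D * 2 + 4)
  kernel-size d p D S I J D≡ d≤p ∣I∣ ∣J∣ degenerate obstruct =
    let l , l≤ , c = low-cover p D S (I ∪ J) D≡ obstruct (suc D) ∅ (≤-reflexive (cong (_+ suc D) (sym (∣⊥∣≡0 n))))
        IJ = elements (I ∪ J)
        covers : ∀ {x} → x ∈ S → ∣ N x ∩ S ∣ < D → x ∈ₗ IJ ++ l
        covers {x} x∈S low = case x ∈? (I ∪ J) of λ
          { (yes x∈) → ∈-++⁺ˡ (∈-elements⁺ x∈)
          ; (no x∉)  → ∈-++⁺ʳ IJ (c x∈S x∉ low (λ q → contradiction q ∉⊥)) }
        IJ≤ : length IJ ≤ p + p
        IJ≤ = ≤-trans (≤-reflexive (length-elements (I ∪ J))) (≤-trans (∣p∪q∣≤∣p∣+∣q∣ I J) (+-mono-≤ ∣I∣ ∣J∣))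
    in ≤-trans (size≤low d D S (IJ ++ l) degenerate (≤-trans (s≤s (+-mono-≤ d≤p d≤p)) (≤-reflexive (sym D≡))) covers)
         (≤-trans (*-monoˡ-≤ D (≤-trans (≤-reflexive (length-++ IJ)) (+-mono-≤ IJ≤ l≤))) arithmetic)
    where
    M = (D * D) ^ suc D
    1≤D : 1 ≤ D
    1≤D = ≤-trans (s≤s z≤n) (≤-reflexive (sym D≡))
    1≤M : 1 ≤ M
    1≤M = ≤-trans (≤-reflexive (sym (^-zeroˡ (suc D)))) (^-monoˡ-≤ (suc D) (*-mono-≤ 1≤D 1≤D))
    arithmetic : (p + p + M) * D ≤ D ^ (D * 2 + 4)
    arithmetic = begin
      (p + p + M) * D          ≤⟨ *-monoˡ-≤ D (+-monoˡ-≤ M (≤-trans (≤-reflexive (sym (*-identityʳ (p + p)))) (*-monoʳ-≤ (p + p) 1≤M))) ⟩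
      ((p + p) * M + M) * D    ≡⟨ cong (_* D) (trans (+-comm ((p + p) * M) M) (cong (_* M) (sym D≡))) ⟩
      D * M * D                ≡⟨ *-comm (D * M) D ⟩
      D * (D * M)              ≡⟨ sym (*-assoc D D M) ⟩
      (D * D) * M              ≡⟨ cong (λ z → z ^ suc (suc D)) (cong (D *_) (sym (*-identityʳ D))) ⟩
      (D ^ 2) ^ (2 + D)        ≡⟨ ^-*-assoc D 2 (2 + D) ⟩
      D ^ (2 * (2 + D))        ≡⟨ cong (D ^_) (trans (*-comm 2 (2 + D)) (+-comm 4 (D * 2))) ⟩
      D ^ (D * 2 + 4)          ∎
      where open ≤-Reasoning

-- The fixed point of pruning and its properties

does⁻ : ∀ {A : Set} (d : Dec A) → does d ≡ true → A
does⁻ (yes a) _ = a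

not-does⁻ : ∀ {A : Set} (d : Dec A) → not (does d) ≡ true → ¬ A
not-does⁻ (no ¬a) _ = ¬a

∧-true : ∀ {a b} → a ∧ b ≡ true → a ≡ true × b ≡ true
∧-true {true} eq = refl , eq

if-cases : ∀ {A : Set} b {x y : A} → (if b then x else y) ≡ y ⊎ (b ≡ true × (if b then x else y) ≡ x)
if-cases false = inj₁ refl
if-cases true  = inj₂ (refl , refl)

module _ {A S : Set} (f : S → A → S) (μ : S → ℕ) (h : ∀ s x → f s x ≡ s ⊎ μ (f s x) < μ s) where

  -- Every step that is not idle lowers the measure, so a fold that does not lower it was idle
  -- throughout. In a pass that changes nothing, every vertex has therefore been tested against the
  -- final set.
  foldl-decreases : ∀ xs s → (foldl f s xs ≡ s × (∀ {x} → x ∈ₗ xs → f s x ≡ s)) ⊎ μ (foldl f s xs) < μ s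
  foldl-decreases []       s = inj₁ (refl , λ ())
  foldl-decreases (x ∷ xs) s with h s x | foldl-decreases xs (f s x)
  ... | inj₁ eq | inj₁ (eqs , all) rewrite eq = inj₁ (eqs , λ { (here refl) → eq ; (there i) → all i })
  ... | inj₁ eq | inj₂ lt          rewrite eq = inj₂ lt
  ... | inj₂ lt | inj₁ (eqs , all)            = inj₂ (≤-trans (s≤s (≤-reflexive (cong μ eqs))) lt)
  ... | inj₂ lt | inj₂ lt′                    = inj₂ (<-trans lt′ lt)

module _ {A S : Set} (g : S → S) (μ : S → ℕ) (h : ∀ s → g s ≡ s ⊎ μ (g s) < μ s) where

  iterate-stabilises : ∀ (xs : List A) s → μ s ≤ length xs → let t = foldl (λ s _ → g s) s xs in g t ≡ t
  iterate-stabilises xs s μ≤ with go xs s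
    where
    go : ∀ (xs : List A) s → let t = foldl (λ s _ → g s) s xs in g t ≡ t ⊎ μ t + length xs ≤ μ s
    go []       s = inj₂ (≤-reflexive (+-identityʳ _))
    go (x ∷ xs) s with go xs (g s)
    ... | inj₁ fixed = inj₁ fixed
    ... | inj₂ le with h s
    ...   | inj₁ eq = inj₁ (subst (λ t → g t ≡ t) (sym (still xs)) eq)
      where
      still : ∀ (xs : List A) → foldl (λ s _ → g s) (g s) xs ≡ s
      still []       = eq
      still (x ∷ xs) = trans (cong (λ z → foldl (λ s _ → g s) (g z) xs) eq) (still xs)
    ...   | inj₂ lt = inj₂ (≤-trans (≤-reflexive (+-suc _ _)) (≤-trans (s≤s le) lt))
  ... | inj₁ fixed = fixed
  ... | inj₂ le with h (foldl (λ s _ → g s) s xs)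
  ...   | inj₁ fixed = fixed
  ...   | inj₂ lt    = contradiction (≤-trans (+-monoˡ-≤ (length xs) lt) (≤-trans le μ≤)) (≤⇒≯ (m≤n+m (length xs) _))

module Kernelisation {n : ℕ} (N : Fin n → Subset n) (irreflexive : ∀ {u} → u ∉ N u) (symmetric : ∀ {u v} → v ∈ N u → u ∈ N v)
  (I J : Subset n) (D p : ℕ) (P : List Bool) (∣P∣ : length P ≡ suc p) where
  open Algorithm N
  open Greedy N
  open Tokens N irreflexive symmetric

  prune-cases : ∀ S u → prune I J D P S u ≡ S ⊎
    (u ∈ S × u ∉ I × u ∉ J × redundant D P S u ≡ true × prune I J D P S u ≡ S ─ ⁅ u ⁆)
  prune-cases S u with if-cases (does (nonempty? (⁅ u ⁆ ∩ S)) ∧ not (does (nonempty? (⁅ u ⁆ ∩ I))) ∧ not (does (nonempty? (⁅ u ⁆ ∩ J)))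
         ∧ redundant D P S u) {S ─ ⁅ u ⁆} {S}
  ... | inj₁ eq = inj₁ eq
  ... | inj₂ (b , eq) =
    let b₁ , b′  = ∧-true b
        b₂ , b″  = ∧-true {not (does (nonempty? (⁅ u ⁆ ∩ I)))} b′
        b₃ , b₄  = ∧-true {not (does (nonempty? (⁅ u ⁆ ∩ J)))} b″
    in  inj₂ ( meets-singleton (does⁻ (nonempty? (⁅ u ⁆ ∩ S)) b₁)
             , not-does⁻ (nonempty? (⁅ u ⁆ ∩ I)) b₂ ∘ singleton-meets
             , not-does⁻ (nonempty? (⁅ u ⁆ ∩ J)) b₃ ∘ singleton-meets
             , b₄ , eq )

  prune-removes : ∀ {S u} → u ∈ S → u ∉ I → u ∉ J → redundant D P S u ≡ true → prune I J D P S u ≡ S ─ ⁅ u ⁆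
  prune-removes {S} {u} u∈S u∉I u∉J red
    rewrite dec-true (nonempty? (⁅ u ⁆ ∩ S)) (singleton-meets u∈S)
          | dec-false (nonempty? (⁅ u ⁆ ∩ I)) (u∉I ∘ meets-singleton)
          | dec-false (nonempty? (⁅ u ⁆ ∩ J)) (u∉J ∘ meets-singleton)
          | red = refl

  prune-decreases : ∀ S u → prune I J D P S u ≡ S ⊎ ∣ prune I J D P S u ∣ < ∣ S ∣
  prune-decreases S u with prune-cases S u
  ... | inj₁ eq = inj₁ eq
  ... | inj₂ (u∈S , _ , _ , _ , eq) = inj₂ (≤-trans (s≤s (≤-reflexive (cong ∣_∣ eq))) (x∈p⇒∣p-x∣<∣p∣ u∈S))

  pass-decreases : ∀ S → pass I J D P S ≡ S ⊎ ∣ pass I J D P S ∣ < ∣ S ∣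
  pass-decreases S with foldl-decreases (prune I J D P) ∣_∣ prune-decreases (allFin n) S
  ... | inj₁ (eq , _) = inj₁ eq
  ... | inj₂ lt       = inj₂ lt

  kernel-stable : let S = kernel I J D P in pass I J D P S ≡ S
  kernel-stable = iterate-stabilises (pass I J D P) ∣_∣ pass-decreases (allFin n) full
    (≤-reflexive (trans (∣⊤∣≡n n) (sym (List.length-tabulate {n = n} id))))

  kernel-obstructed : let S = kernel I J D P in ∀ {u} → u ∈ S → u ∉ I ∪ J → Obstruction D p S u
  kernel-obstructed {u} u∈S u∉ with redundant D P (kernel I J D P) u in eq
  ... | false = irredundant⇒obstruction D p P (kernel I J D P) u ∣P∣ eq
  ... | true with foldl-decreases (prune I J D P) ∣_∣ prune-decreases (allFin n) (kernel I J D P)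
  ...   | inj₂ lt = contradiction (≤-trans (s≤s (≤-reflexive (cong ∣_∣ (sym kernel-stable)))) lt) (<-irrefl refl)
  ...   | inj₁ (_ , fixed) = contradiction (≤-trans (s≤s (≤-reflexive (cong ∣_∣ same))) (x∈p⇒∣p-x∣<∣p∣ u∈S)) (<-irrefl refl)
    where
    same : kernel I J D P ≡ kernel I J D P ─ ⁅ u ⁆
    same = trans (sym (fixed (∈-allFin u)))
      (prune-removes u∈S (λ p → u∉ (x∈p∪q⁺ (inj₁ p))) (λ p → u∉ (x∈p∪q⁺ (inj₂ p))) eq)

  module _ (k′ : ℕ) (k≤p : suc k′ ≤ p) where

    Preserved : Subset n → Set
    Preserved S = I ⊆ S × J ⊆ S × Path k′ S I J

    prune-preserves : ∀ S u → Preserved S → Preserved (prune I J D P S u)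
    prune-preserves S u pr@(I⊆S , J⊆S , path) with prune-cases S u
    ... | inj₁ eq = subst Preserved (sym eq) pr
    ... | inj₂ (u∈S , u∉I , u∉J , red , eq) = subst Preserved (sym eq)
      ( (λ {x} x∈ → x∈p∧x≢y⇒x∈p-y (I⊆S x∈) λ { refl → u∉I x∈ })
      , (λ {x} x∈ → x∈p∧x≢y⇒x∈p-y (J⊆S x∈) λ { refl → u∉J x∈ })
      , avoid path u∉I )
      where
      open Exchange k′ {S} {S ─ ⁅ u ⁆} {J} {u}
        (redundant⇒replaceable irreflexive symmetric k′ D P S u (≤-trans (s≤s k≤p) (≤-reflexive (sym ∣P∣))) red)
        u∉J x∈p∧x≢y⇒x∈p-y

    kernel-preserves : Path k′ full I J → Preserved (kernel I J D P)
    kernel-preserves path =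
      foldl-invariant Preserved (λ S _ → foldl-invariant Preserved prune-preserves (allFin n)) (allFin n)
        ((λ _ → ∈⊤) , (λ _ → ∈⊤) , path)

-- The exhaustive search

△⁺ˡ : ∀ {n} {A B : Subset n} {x} → x ∈ A → x ∉ B → x ∈ A △ B
△⁺ˡ p q = x∈p∪q⁺ (inj₁ (x∈p∧x∉q⇒x∈p─q p q))

△⁺ʳ : ∀ {n} {A B : Subset n} {x} → x ∉ A → x ∈ B → x ∈ A △ B
△⁺ʳ p q = x∈p∪q⁺ (inj₂ (x∈p∧x∉q⇒x∈p─q q p))

△⁻ : ∀ {n} {A B : Subset n} {x} → x ∈ A △ B → (x ∈ A × x ∉ B) ⊎ (x ∈ B × x ∉ A)
△⁻ {A = A} {B} p with x∈p∪q⁻ (A ─ B) (B ─ A) p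
... | inj₁ q = inj₁ (p─q⊆p A B q , x∉p─q A B q)
... | inj₂ q = inj₂ (p─q⊆p B A q , x∉p─q B A q)

△-empty : ∀ {n} {A B : Subset n} → ¬ Nonempty (A △ B) → A ≡ B
△-empty {A = A} {B} e = ⊆-antisym
  (λ {x} p → case x ∈? B of λ { (yes q) → q ; (no q) → contradiction (x , △⁺ˡ p q) e })
  (λ {x} p → case x ∈? A of λ { (yes q) → q ; (no q) → contradiction (x , △⁺ʳ q p) e })

△-self : ∀ {n} {A : Subset n} → ¬ Nonempty (A △ A)
△-self (x , p) with △⁻ p
... | inj₁ (a , b) = b a
... | inj₂ (a , b) = b a

Nonempty⇒0<∣∣ : ∀ {n} {X : Subset n} → Nonempty X → 0 < ∣ X ∣
Nonempty⇒0<∣∣ (x , x∈X) = ≤-trans (s≤s z≤n) (x∈p⇒∣p-x∣<∣p∣ x∈X)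

unique-element : ∀ {n} {X : Subset n} → ∣ X ∣ ≡ 1 → ∃[ u ] (u ∈ X × (∀ {x} → x ∈ X → x ≡ u))
unique-element {n} {X} eq with nonempty? X
... | no e rewrite Empty-unique e = contradiction (trans (sym eq) (∣⊥∣≡0 n)) λ ()
... | yes (u , u∈X) = u , u∈X , λ {x} x∈X → case x Fin.≟ u of λ
  { (yes x≡u) → x≡u
  ; (no x≢u)  → contradiction (≤-trans (s≤s (Nonempty⇒0<∣∣ (x , x∈p∧x≢y⇒x∈p-y x∈X x≢u))) (x∈p⇒∣p-x∣<∣p∣ u∈X)) (λ h → <-irrefl refl (≤-trans h (≤-reflexive eq))) }

module _ {A : Set} (g : A → Bool) where

  foldl-∧⁺ : ∀ xs → (∀ x → g x ≡ true) → foldl (λ b x → b ∧ g x) true xs ≡ true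
  foldl-∧⁺ []       h = refl
  foldl-∧⁺ (x ∷ xs) h rewrite h x = foldl-∧⁺ xs h

  foldl-∧⁻ : ∀ xs {b} → foldl (λ b x → b ∧ g x) b xs ≡ true → b ≡ true × (∀ {x} → x ∈ₗ xs → g x ≡ true)
  foldl-∧⁻ []       eq = eq , λ ()
  foldl-∧⁻ (x ∷ xs) {b} eq with foldl-∧⁻ xs eq
  ... | eq′ , all with ∧-true {b} eq′
  ...   | b≡ , gx = b≡ , λ { (here refl) → gx ; (there i) → all i }

  foldl-∨⁺ : ∀ {xs x b} → x ∈ₗ xs → g x ≡ true → foldl (λ b x → if b then true else g x) b xs ≡ true
  foldl-∨⁺ {xs = _ ∷ xs} {b = b} (here refl) eq rewrite eq = trans (cong (λ z → foldl _ z xs) (lemma b)) (stays xs)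
    where
    lemma : ∀ b → (if b then true else true) ≡ true
    lemma false = refl
    lemma true  = refl
    stays : ∀ xs → foldl (λ b x → if b then true else g x) true xs ≡ true
    stays []       = refl
    stays (_ ∷ xs) = stays xs
  foldl-∨⁺ (there i) eq = foldl-∨⁺ i eq

module Decide {n : ℕ} (N : Fin n → Subset n) (irreflexive : ∀ {u} → u ∉ N u) (symmetric : ∀ {u v} → v ∈ N u → u ∈ N v)
  (k′ : ℕ) (kl one : List Bool) (∣kl∣ : length kl ≡ suc k′) (∣one∣ : length one ≡ 1) where
  open Algorithm N
  open Tokens N irreflexive symmetric k′

  IsNode : Subset n → Set
  IsNode A = Indep A × (∣ A ∣ ≡ k′ ⊎ ∣ A ∣ ≡ suc k′)

  Edge : Subset n → Subset n → Set
  Edge A B = IsNode A × IsNode B × ∣ A △ B ∣ ≡ 1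

  independent⁻ : ∀ {A} → independent A ≡ true → Indep A
  independent⁻ {A} eq {u} {v} u∈A v∈A v∈N with proj₂ (foldl-∧⁻ _ (allFin n) eq) (∈-allFin u)
  ... | h = not-does⁻ (nonempty? (⁅ u ⁆ ∩ A) ×-dec nonempty? (N u ∩ A)) h (singleton-meets u∈A , v , x∈p∩q⁺ (v∈N , v∈A))

  independent⁺ : ∀ {A} → Indep A → independent A ≡ true
  independent⁺ {A} iA = foldl-∧⁺ _ (allFin n) λ i → cong not
    (dec-false (nonempty? (⁅ i ⁆ ∩ A) ×-dec nonempty? (N i ∩ A)) λ (p , v , q) →
      let v∈N , v∈A = x∈p∩q⁻ (N i) A q in iA (meets-singleton p) v∈A v∈N)

  short⁻ : ∀ (l : List Bool) → not (nonempty (tail′ l)) ≡ true → length l ≤ 1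
  short⁻ []          _ = z≤n
  short⁻ (_ ∷ [])    _ = ≤-refl

  short⁺ : ∀ (l : List Bool) → length l ≤ 1 → not (nonempty (tail′ l)) ≡ true
  short⁺ []          _ = refl
  short⁺ (_ ∷ [])    _ = refl
  short⁺ (_ ∷ _ ∷ _) (s≤s ())

  ∣drop∣ : ∀ m → length (drop m kl) ≡ suc k′ ∸ m
  ∣drop∣ m = trans (List.length-drop m kl) (cong (_∸ m) ∣kl∣)

  node⁻ : ∀ {A} → node kl A ≡ true → IsNode A
  node⁻ {A} eq =
    let a , bc = ∧-true {independent A} eq
        b , c  = ∧-true {does (∣ A ∣ ≤? length kl)} bc
    in  independent⁻ a , sizes (≤-trans (does⁻ (∣ A ∣ ≤? length kl) b) (≤-reflexive ∣kl∣))
          (≤-trans (≤-reflexive (sym (∣drop∣ ∣ A ∣))) (short⁻ (drop ∣ A ∣ kl) c))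
    where
    sizes : ∀ {m} → m ≤ suc k′ → suc k′ ∸ m ≤ 1 → m ≡ k′ ⊎ m ≡ suc k′
    sizes {m} m≤ d with m Data.Nat.≟ suc k′
    ... | yes eq = inj₂ eq
    ... | no  ne = inj₁ (≤-antisym (s≤s⁻¹ (≤∧≢⇒< m≤ ne))
      (s≤s⁻¹ (≤-trans (m≤n+m∸n (suc k′) m) (≤-trans (+-monoʳ-≤ m d) (≤-reflexive (+-comm m 1))))))

  upper : ∀ {m} → m ≡ k′ ⊎ m ≡ suc k′ → m ≤ suc k′
  upper (inj₁ eq) = ≤-trans (≤-reflexive eq) (n≤1+n k′)
  upper (inj₂ eq) = ≤-reflexive eq
  lower : ∀ {m} → m ≡ k′ ⊎ m ≡ suc k′ → k′ ≤ m
  lower (inj₁ eq) = ≤-reflexive (sym eq)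
  lower (inj₂ eq) = ≤-trans (n≤1+n k′) (≤-reflexive (sym eq))

  node⁺ : ∀ {A} → IsNode A → node kl A ≡ true
  node⁺ {A} (iA , sz)
    rewrite independent⁺ iA | dec-true (∣ A ∣ ≤? length kl) (≤-trans (upper sz) (≤-reflexive (sym ∣kl∣))) =
      short⁺ (drop ∣ A ∣ kl) (≤-trans (≤-reflexive (∣drop∣ ∣ A ∣)) (≤-trans (∸-monoʳ-≤ (suc k′) (lower sz)) (≤-reflexive (m+n∸n≡m 1 k′))))

  move-edge : ∀ A B → IsNode A → let C = move kl one A B in IsNode C × Star Edge A C
  move-edge A B nA with if-cases (node kl B ∧ does (∣ A △ B ∣ ≤? length one)) {B} {A}
  ... | inj₁ eq = subst (λ C → IsNode C × Star Edge A C) (sym eq) (nA , ε)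
  ... | inj₂ (b , eq) with ∧-true {node kl B} b
  ...   | b₁ , b₂ with node⁻ b₁ | ≤-trans (does⁻ (∣ A △ B ∣ ≤? length one) b₂) (≤-reflexive ∣one∣)
  ...     | nB | le = subst (λ C → IsNode C × Star Edge A C) (sym eq) (nB , path)
    where
    path : Star Edge A B
    path with ∣ A △ B ∣ Data.Nat.≟ 1
    ... | yes one = (nA , nB , one) ◅ ε
    ... | no  ne  = subst (Star Edge A) (△-empty λ ne′ → ne (≤-antisym le (Nonempty⇒0<∣∣ ne′))) ε

  step-node : ∀ {S A B} → Add S A B → IsNode A × IsNode B
  step-node (u , u∉ , refl , eq , iB , _) =
    ((λ p q → iB (⊆⊞ p) (⊆⊞ q)) , inj₁ eq) , iB , inj₂ (trans (∣⊞∣ u∉) (cong suc eq))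

  ∣△⊞∣ : ∀ (A : Subset n) u → ∣ A △ (A ⊞ u) ∣ ≤ 1 × ∣ (A ⊞ u) △ A ∣ ≤ 1
  ∣△⊞∣ A u = covered-≤ (u ∷ []) (A △ (A ⊞ u)) (λ p → case △⁻ p of λ { (inj₁ q) → here (differs (proj₂ q) (proj₁ q)) ; (inj₂ q) → here (differs′ q) })
           , covered-≤ (u ∷ []) ((A ⊞ u) △ A) (λ p → case △⁻ p of λ { (inj₁ q) → here (differs′ q) ; (inj₂ q) → here (differs (proj₂ q) (proj₁ q)) })
    where
    differs : ∀ {x} → x ∉ A ⊞ u → x ∈ A → x ≡ u
    differs p q = contradiction (⊆⊞ q) p
    differs′ : ∀ {x} → x ∈ A ⊞ u × x ∉ A → x ≡ u
    differs′ (p , q) with ∈⊞⁻ p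
    ... | inj₁ eq = eq
    ... | inj₂ r  = contradiction r q

  step-target : ∀ {S A B} → Step S A B → IsNode B
  step-target (inj₁ a) = proj₂ (step-node a)
  step-target (inj₂ a) = proj₁ (step-node a)

  step-close : ∀ {S A B} → Step S A B → ∣ A △ B ∣ ≤ 1
  step-close {A = A} (inj₁ (u , _ , refl , _)) = proj₁ (∣△⊞∣ A u)
  step-close {B = B} (inj₂ (u , _ , refl , _)) = proj₂ (∣△⊞∣ B u)

  move-step : ∀ {S A B} → Step S A B → move kl one A B ≡ B
  move-step {A = A} {B} s
    rewrite node⁺ (step-target s) | dec-true (∣ A △ B ∣ ≤? length one) (≤-trans (step-close s) (≤-reflexive (sym ∣one∣))) = refl

  -- Lets a walk be padded to the fixed length of the tabulated sequences: naming the present set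
  -- again is harmless.
  move-stay : ∀ A → move kl one A A ≡ A
  move-stay A with node kl A ∧ does (∣ A △ A ∣ ≤? length one)
  ... | false = refl
  ... | true  = refl

  grow : ∀ {A B u} → IsNode A → IsNode B → u ∈ B → u ∉ A → (∀ {x} → x ∈ A → x ∈ B) → (∀ {x} → x ∈ B → x ∉ A → x ≡ u) → Add full A B
  grow {A} {B} {u} (_ , sA) (iB , sB) u∈B u∉A A⊆B only = u , u∉A , B≡ , sizes sA sB , iB , λ _ → ∈⊤
    where
    B≡ : B ≡ A ⊞ u
    B≡ = ⊆-antisym (λ {x} x∈B → case x ∈? A of λ { (yes p) → ⊆⊞ p ; (no p) → subst (_∈ A ⊞ u) (sym (only x∈B p)) ∈⊞ })
           (λ p → case ∈⊞⁻ p of λ { (inj₁ refl) → u∈B ; (inj₂ q) → A⊆B q })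
    ∣B∣ : ∣ B ∣ ≡ suc ∣ A ∣
    ∣B∣ = trans (cong ∣_∣ B≡) (∣⊞∣ u∉A)
    sizes : ∣ A ∣ ≡ k′ ⊎ ∣ A ∣ ≡ suc k′ → ∣ B ∣ ≡ k′ ⊎ ∣ B ∣ ≡ suc k′ → ∣ A ∣ ≡ k′
    sizes (inj₁ eq) _         = eq
    sizes (inj₂ _)  (inj₂ eq) = suc-injective (trans (sym ∣B∣) eq)
    sizes (inj₂ e₁) (inj₁ e₂) = contradiction (trans (sym e₂) (trans ∣B∣ (cong suc e₁))) (<⇒≢ (s≤s (n≤1+n k′)))

  edge⇒step : ∀ {A B} → Edge A B → Step full A B
  edge⇒step {A} {B} (nA , nB , one) with unique-element one
  ... | u , u∈ , only with △⁻ {A = A} {B} u∈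
  ...   | inj₂ (u∈B , u∉A) = inj₁ (grow nA nB u∈B u∉A
            (λ {x} p → case x ∈? B of λ { (yes q) → q ; (no q) → contradiction (subst (_∈ A) (only (△⁺ˡ p q)) p) u∉A })
            (λ p q → only (△⁺ʳ q p)))
  ...   | inj₁ (u∈A , u∉B) = inj₂ (grow nB nA u∈A u∉B
            (λ {x} p → case x ∈? A of λ { (yes q) → q ; (no q) → contradiction (subst (_∈ B) (only (△⁺ʳ q p)) p) u∉B })
            (λ p q → only (△⁺ˡ p q)))

  -- Every sequence is replayed by `move` as a walk in the whole graph, so the answer `true` is
  -- correct for any `S` and any list of sequences.
  search-sound : ∀ {I J} S Qs → IsNode I → search I J kl one S Qs ≡ true → Star Edge I J
  search-sound {I} {J} S Qs nI = foldl-invariant (λ b → b ≡ true → Star Edge I J) step Qs λ ()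
    where
    end : List (List Bool) → Subset n
    end qs = foldl (λ A q → move kl one A (spread S q)) I qs
    walk : ∀ qs → IsNode (end qs) × Star Edge I (end qs)
    walk qs = foldl-invariant (λ A → IsNode A × Star Edge I A)
      (λ A q (nA , p) → let nC , p′ = move-edge A (spread S q) nA in nC , p ◅◅ p′) qs (nI , ε)
    step : ∀ b qs → (b ≡ true → Star Edge I J) → (if b then true else not (does (nonempty? (end qs △ J)))) ≡ true → Star Edge I J
    step true  qs h eq = h refl
    step false qs h eq = subst (Star Edge I) (△-empty (not-does⁻ (nonempty? (end qs △ J)) eq)) (proj₂ (walk qs))

module _ {X : Set} where

  Distinct : List X → Set
  Distinct []       = ⊤
  Distinct (x ∷ xs) = x ∉ₗ xs × Distinct xs

  distinct-≤ : ∀ xs {ys} → Distinct xs → (∀ {x} → x ∈ₗ xs → x ∈ₗ ys) → length xs ≤ length ys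
  distinct-≤ []       _        _   = z≤n
  distinct-≤ (x ∷ xs) (x∉ , d) sub with ∈-∃++ (sub (here refl))
  ... | as , bs , refl = ≤-trans (s≤s (distinct-≤ xs d sub′))
        (≤-reflexive (trans (cong suc (length-++ as)) (trans (sym (+-suc (length as) (length bs))) (sym (length-++ as)))))
    where
    sub′ : ∀ {y} → y ∈ₗ xs → y ∈ₗ as ++ bs
    sub′ y∈ with ∈-++⁻ as (sub (there y∈))
    ... | inj₁ p           = ∈-++⁺ˡ p
    ... | inj₂ (here refl) = contradiction y∈ x∉
    ... | inj₂ (there p)   = ∈-++⁺ʳ as p

  data Walk (R : X → X → Set) : X → List X → X → Set where
    []  : ∀ {x} → Walk R x [] x
    _∷_ : ∀ {x y ys z} → R x y → Walk R y ys z → Walk R x (y ∷ ys) z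

  module _ {R : X → X → Set} (_≟_ : ∀ (x y : X) → Dec (x ≡ y)) where

    cut : ∀ {x y ys z} → Walk R y ys z → Distinct (y ∷ ys) → x ∈ₗ y ∷ ys → ∃[ xs ] (Walk R x xs z × Distinct (x ∷ xs))
    cut w       d       (here refl) = _ , w , d
    cut (r ∷ w) (_ , d) (there i)   = cut w d i

    -- Loop erasure from the far end: if a new first vertex recurs later, the walk is cut back to
    -- that recurrence.
    shorten : ∀ {x z} → Star R x z → ∃[ xs ] (Walk R x xs z × Distinct (x ∷ xs))
    shorten ε = [] , [] , (λ ()) , tt
    shorten {x} (_◅_ {j = y} r p) with shorten p
    ... | ys , w , d with any? (x ≟_) (y ∷ ys)
    ...   | yes i = cut w d i
    ...   | no  i = y ∷ ys , r ∷ w , i , d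

gather : ∀ {m} → Subset m → Subset m → List Bool
gather []          []      = []
gather (false ∷ S) (_ ∷ A) = gather S A
gather (true  ∷ S) (a ∷ A) = a ∷ gather S A

length-gather : ∀ {m} (S A : Subset m) → length (gather S A) ≡ ∣ S ∣
length-gather []          []      = refl
length-gather (false ∷ S) (_ ∷ A) = length-gather S A
length-gather (true  ∷ S) (a ∷ A) = cong suc (length-gather S A)

spread-gather : ∀ {m} (S A : Subset m) l → A ⊆ S → spread S (gather S A ++ l) ≡ A
spread-gather []          []          l A⊆S = refl
spread-gather (false ∷ S) (false ∷ A) l A⊆S = cong (false ∷_) (spread-gather S A l (drop-∷-⊆ A⊆S))
spread-gather (false ∷ S) (true  ∷ A) l A⊆S = case A⊆S Data.Vec.here of λ ()
spread-gather (true  ∷ S) (a     ∷ A) l A⊆S = cong (a ∷_) (spread-gather S A l (drop-∷-⊆ A⊆S))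

module Complete {n : ℕ} (N : Fin n → Subset n) (irreflexive : ∀ {u} → u ∉ N u) (symmetric : ∀ {u v} → v ∈ N u → u ∈ N v)
  (k′ : ℕ) (kl one : List Bool) (∣kl∣ : length kl ≡ suc k′) (∣one∣ : length one ≡ 1)
  {B : Set} (S : Subset n) (Ks : List B) (∣S∣≤ : ∣ S ∣ ≤ length Ks) where
  open Algorithm N
  open Tokens N irreflexive symmetric k′
  open Decide N irreflexive symmetric k′ kl one ∣kl∣ ∣one∣

  bits : List Bool
  bits = false ∷ true ∷ []

  codes : List (List Bool)
  codes = sequences bits Ks

  -- All tabulated codes share the length of `Ks`, so the bits are padded; `spread` ignores the
  -- surplus.
  code-of : Subset n → List Bool
  code-of A = gather S A ++ unary (length Ks ∸ ∣ S ∣)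

  code-of∈ : ∀ A → code-of A ∈ₗ codes
  code-of∈ A = ∈-sequences bits Ks (All.universal (λ { false → here refl ; true → there (here refl) }) (code-of A))
    (trans (length-++ (gather S A)) (trans (cong₂ _+_ (length-gather S A) (length-replicate (length Ks ∸ ∣ S ∣))) (m+[n∸m]≡n ∣S∣≤)))

  spread-code : ∀ {A} → A ⊆ S → spread S (code-of A) ≡ A
  spread-code {A} A⊆S = spread-gather S A _ A⊆S

  step⊆ : ∀ {A C} → Step S A C → C ⊆ S
  step⊆ (inj₁ (_ , _ , refl , _ , _ , C⊆S)) = C⊆S
  step⊆ (inj₂ (_ , _ , refl , _ , _ , A⊆S)) = A⊆S ∘ ⊆⊞

  walk⊆ : ∀ {A xs C} → A ⊆ S → Walk (Step S) A xs C → ∀ {X} → X ∈ₗ A ∷ xs → X ⊆ S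
  walk⊆ A⊆S w       (here refl) = A⊆S
  walk⊆ A⊆S (s ∷ w) (there i)   = walk⊆ (step⊆ s) w i

  follow : Subset n → List Bool → Subset n
  follow A q = move kl one A (spread S q)

  follow-stay : ∀ {J} m → J ⊆ S → foldl follow J (replicate m (code-of J)) ≡ J
  follow-stay zero    J⊆S = refl
  follow-stay {J} (suc m) J⊆S =
    trans (cong (λ Z → foldl follow Z (replicate m (code-of J))) (trans (cong (move kl one J) (spread-code J⊆S)) (move-stay J)))
      (follow-stay m J⊆S)

  follow-walk : ∀ {A xs J} m → A ⊆ S → Walk (Step S) A xs J → foldl follow A (map code-of xs ++ replicate m (code-of J)) ≡ J
  follow-walk m A⊆S [] = follow-stay m A⊆S
  follow-walk {A} {J = J} m A⊆S (_∷_ {y = C} {xs} s w) =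
    trans (cong (λ Z → foldl follow Z (map code-of xs ++ replicate m (code-of J)))
        (trans (cong (move kl one A) (spread-code (step⊆ s))) (move-step s)))
      (follow-walk m (step⊆ s) w)

  -- A path without repetitions visits distinct subsets of `S`, each decoded from some code, so it
  -- has fewer steps than there are codes. Repeating the code of `J` then fills the sequence up.
  search-complete : ∀ {I J} → I ⊆ S → Path S I J → search I J kl one S (sequences codes codes) ≡ true
  search-complete {I} {J} I⊆S path with shorten (Vec.≡-dec Bool._≟_) path
  ... | xs , w , d = foldl-∨⁺ _ qs∈ (cong not (dec-false (nonempty? (foldl follow I qs △ J))
          (subst (λ A → ¬ Nonempty (A △ J)) (sym (follow-walk pad I⊆S w)) △-self)))
    where
    pad = length codes ∸ length xs
    qs = map code-of xs ++ replicate pad (code-of J)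
    short : length xs ≤ length codes
    short = ≤-trans (n≤1+n _) (≤-trans (distinct-≤ (I ∷ xs) d λ {A} i →
        subst (_∈ₗ map (spread S) codes) (spread-code (walk⊆ I⊆S w i)) (∈-map⁺ (spread S) (code-of∈ A)))
      (≤-reflexive (length-map (spread S) codes)))
    qs∈ : qs ∈ₗ sequences codes codes
    qs∈ = ∈-sequences codes codes
      (++⁺ (map⁺ (All.universal (λ A → code-of∈ A) xs)) (replicate⁺ pad (code-of∈ J)))
      (trans (length-++ (map code-of xs)) (trans (cong₂ _+_ (length-map code-of xs) (length-replicate pad)) (m+[n∸m]≡n short)))

-- Correctness for a given instance

module Correctness (x : ISRInstance) where
  open ISRInstance x
  open Graph G renaming (order to n)

  p : ℕ
  p = k + d

  -- Looked up in the encoded rows instead of being `neighbours` itself, which keeps `answer≡`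
  -- definitional.
  N : Fin n → Subset n
  N = lookup (tabulate neighbours)

  ∈N⁻ : ∀ {u v} → v ∈ N u → Adjacent u v
  ∈N⁻ {u} {v} v∈ = subst T (sym (trans (sym (Vec.lookup∘tabulate (adj u) v))
    (trans (cong (λ A → lookup A v) (sym (Vec.lookup∘tabulate neighbours u))) (Vec.[]=⇒lookup v∈)))) tt

  ∈N⁺ : ∀ {u v} → Adjacent u v → v ∈ N u
  ∈N⁺ {u} {v} uv = Vec.lookup⇒[]= v (N u) (trans (cong (λ A → lookup A v) (Vec.lookup∘tabulate neighbours u))
    (trans (Vec.lookup∘tabulate (adj u) v) (T⇒≡ uv)))
    where
    T⇒≡ : ∀ {b} → T b → b ≡ true
    T⇒≡ {true} _ = refl

  irreflexive : ∀ {u} → u ∉ N u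
  irreflexive u∈ = irrefl _ (∈N⁻ u∈)

  symmetric : ∀ {u v} → v ∈ N u → u ∈ N v
  symmetric v∈ = ∈N⁺ (symm _ _ (∈N⁻ v∈))

  k′ : ℕ
  k′ = k ∸ 1

  k≡ : k ≡ suc k′
  k≡ = lemma k>0
    where
    lemma : ∀ {k} → 0 < k → k ≡ suc (k ∸ 1)
    lemma (s≤s _) = refl

  ∣k∣ : length (unary k) ≡ suc k′
  ∣k∣ = trans (length-replicate k) k≡

  D : ℕ
  D = length (degreeTable p)

  D≡ : D ≡ suc (p + p)
  D≡ = trans (length-twice (unary 1) (unary p)) (trans (cong (λ m → m * 2 + 1) (length-replicate p))
    (trans (+-comm (p * 2) 1) (cong suc (trans (*-comm p 2) (cong (p +_) (+-identityʳ p))))))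

  open Algorithm N
  open Tokens N irreflexive symmetric k′ using (Indep)
  open Decide N irreflexive symmetric k′ (unary k) (unary 1) ∣k∣ refl
  open Kernelisation N irreflexive symmetric Iₛ Iₜ D p (unary (suc p)) (length-replicate (suc p))
  module R = Reconfiguration G k

  indep⁺ : ∀ {A} → Independent A → Indep A
  indep⁺ iA p q r = iA _ _ p q (∈N⁻ r)

  node⇒IsNode : ∀ {A} → IsNode A → R.IsNode A
  node⇒IsNode (iA , sz) = (λ u v p q r → iA p q (∈N⁺ r)) , (case sz of λ { (inj₁ e) → inj₁ e ; (inj₂ e) → inj₂ (trans e (sym k≡)) })

  IsNode⇒node : ∀ {A} → R.IsNode A → IsNode A
  IsNode⇒node (iA , sz) = indep⁺ iA , (case sz of λ { (inj₁ e) → inj₁ e ; (inj₂ e) → inj₂ (trans e k≡) })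

  S : Subset n
  S = kernel Iₛ Iₜ D (unary (suc p))

  ∣S∣≤ : ∣ S ∣ ≤ length (kernelTable p)
  ∣S∣≤ = ≤-trans
    (Kernel.kernel-size N symmetric d p D S Iₛ Iₜ D≡ (m≤n+m d k)
      (≤-trans (≤-reflexive ∣Iₛ∣≡k) (m≤m+n k d)) (≤-trans (≤-reflexive ∣Iₜ∣≡k) (m≤m+n k d)) degenerate′ kernel-obstructed)
    (≤-reflexive (sym (trans (length-sequences (degreeTable p) (exponentTable p)) (cong (D ^_) (length-twice (unary 4) (degreeTable p))))))
    where
    degenerate′ : ∀ S → Nonempty S → ∃[ v ] (v ∈ S × ∣ N v ∩ S ∣ ≤ d)
    degenerate′ S ne = let v , v∈S , le = degenerate S ne
      in v , v∈S , subst (λ A → ∣ A ∩ S ∣ ≤ d) (sym (Vec.lookup∘tabulate neighbours v)) le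

  open Assemble preF mainF

  answer≡ : answer x ≡ search Iₛ Iₜ (unary k) (unary 1) S (sequences (codeTable p) (codeTable p))
  answer≡ = mainF-computes n (tabulate neighbours) (unary d) (unary k) Iₛ Iₜ (unary (suc p)) (degreeTable p) (unary 1) (codeTable p) (sequences (codeTable p) (codeTable p))

  sound : answer x ≡ true → R.Path Iₛ Iₜ
  sound eq = Star.map (λ (a , b , c) → node⇒IsNode a , node⇒IsNode b , c)
    (search-sound S (sequences (codeTable p) (codeTable p)) (indep⁺ Iₛ-independent , inj₂ (trans ∣Iₛ∣≡k k≡)) (trans (sym answer≡) eq))

  complete : R.Path Iₛ Iₜ → answer x ≡ true
  complete path =
    let I⊆S , _ , path′ = kernel-preserves k′ (≤-trans (≤-reflexive (sym k≡)) (m≤m+n k d))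
          (Star.map (λ (a , b , c) → edge⇒step (IsNode⇒node a , IsNode⇒node b , c)) path)
    in  trans answer≡ (Complete.search-complete N irreflexive symmetric k′ (unary k) (unary 1) ∣k∣ refl S (kernelTable p) ∣S∣≤ I⊆S path′)

theorem2 : FixedParameterTractable ISR
theorem2 = Assemble.tractable preF mainF λ x → mk⇔ (Correctness.complete x) (Correctness.sound x)
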